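{- Let $H = T \cup C$ be a complete Halin graph with characteristic tree $T$ and adjoint cycle $C$, and suppose $|C| \neq 5$. Then \[ \mathrm{ch}'_{\mathrm{star}}(H) \leq \max\left\{ \left\lfloor \frac{\theta(T) + \Delta(T)}{2} \right\rfloor,\ 2\left\lfloor \frac{\Delta(T)}{2} \right\rfloor + 6 \right\}, \] where $\theta(T) = \max_{xy \in E(T)} \{ d_T(x) + d_T(y) \}$.
   Context: All graphs are finite and simple. A star $k$-edge coloring of a graph $G$ is a proper edge coloring $\phi: E(G) \to \{1,\dots,k\}$ such that no path or cycle of length four (i.e. with four edges) in $G$ is bichromatic. Given a list assignment $L$ assigning a finite set $L(e)$ to each edge $e$, $G$ is star $k$-edge choosable if for every $L$ with $|L(e)| \geq k$ for all $e$ there is a star edge coloring $\varphi$ with $\varphi(e) \in L(e)$ for all $e$. The list star chromatic index $\mathrm{ch}'_{\mathrm{star}}(G)$ is the minimum such $k$. A Halin graph $H = T \cup C$ is a plane graph consisting of a plane embedding of a tree $T$ (the characteristic tree) having no vertices of degree $2$, together with a cycle $C$ (the adjoint cycle) connecting all the leaves of $T$ such that $C$ is the boundary of the exterior face. A Halin graph is complete if $T$ has a root vertex $r$ such that all leaves of $T$ are at the same distance from $r$ in $T$. $|C|$ denotes the length of $C$, and $d_T(x)$ the degree of $x$ in $T$. -}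

module Defs where

open import Data.Nat using (ℕ; zero; suc; _+_; _*_; _≤_; _<_; _⊔_)
open import Data.Nat.DivMod using (_/_)
open import Data.Bool using (Bool; true; false; if_then_else_)
open import Data.Fin using (Fin)
open import Data.List using (List; []; _∷_; length; filterᵇ; allFin; map; foldr; concatMap; last)
open import Data.List.Membership.Propositional using (_∈_)
open import Data.List.Relation.Unary.Unique.Propositional using (Unique)
open import Data.List.Relation.Unary.Linked using (Linked)
open import Data.Maybe using (just)
open import Data.Empty using (⊥)
open import Data.Product using (Σ; ∃; ∃-syntax; _×_; _,_; proj₁; proj₂)
open import Data.Sum using (_⊎_)
open import Relation.Binary.PropositionalEquality using (_≡_; _≢_)
open import Relation.Nullary using (¬_)

-- Generic (simple) graphs on vertex set Fin n, given by an adjacency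
-- relation E.  An edge is an unordered pair {x,y} with E x y.

Rel : ℕ → Set₁
Rel n = Fin n → Fin n → Set

data Walk {n : ℕ} (E : Rel n) : Fin n → Fin n → Set where
  []  : ∀ {u} → Walk E u u
  _∷_ : ∀ {u v w} → E u v → Walk E v w → Walk E u w

walkLength : ∀ {n} {E : Rel n} {u v} → Walk E u v → ℕ
walkLength []       = 0
walkLength (_ ∷ w)  = suc (walkLength w)

Dist : ∀ {n} → Rel n → Fin n → Fin n → ℕ → Set
Dist E u v d = (Σ (Walk E u v) λ w → walkLength w ≡ d)
             × (∀ (w : Walk E u v) → d ≤ walkLength w)

Connected : ∀ {n} → Rel n → Set
Connected E = ∀ u v → Walk E u v

IsCycle : ∀ {n} → Rel n → List (Fin n) → Set
IsCycle E []                      = ⊥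
IsCycle E (_ ∷ [])                = ⊥
IsCycle E (_ ∷ _ ∷ [])            = ⊥
IsCycle E (v₀ ∷ v₁ ∷ v₂ ∷ rest)   =
  Unique (v₀ ∷ v₁ ∷ v₂ ∷ rest) × Linked E (v₀ ∷ v₁ ∷ v₂ ∷ rest)
  × Σ (Fin _) (λ w → last (v₀ ∷ v₁ ∷ v₂ ∷ rest) ≡ just w × E w v₀)

Acyclic : ∀ {n} → Rel n → Set
Acyclic E = ∀ xs → ¬ IsCycle E xs

record BGraph (n : ℕ) : Set where
  field
    adj     : Fin n → Fin n → Bool
    sym     : ∀ x y → adj x y ≡ adj y x
    irrefl  : ∀ x → adj x x ≡ false

open BGraph public

Adj : ∀ {n} → BGraph n → Rel n
Adj G x y = adj G x y ≡ true

deg : ∀ {n} → BGraph n → Fin n → ℕ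
deg {n} G x = length (filterᵇ (adj G x) (allFin n))

maxList : List ℕ → ℕ
maxList = foldr _⊔_ 0

Δ : ∀ {n} → BGraph n → ℕ
Δ {n} G = maxList (map (deg G) (allFin n))

θ : ∀ {n} → BGraph n → ℕ
θ {n} G = maxList (concatMap (λ x → map (λ y → if adj G x y then deg G x + deg G y else 0)
                                        (allFin n)) (allFin n))

IsTree : ∀ {n} → BGraph n → Set
IsTree G = Connected (Adj G) × Acyclic (Adj G)

isLeafᵇ : ∀ {n} → BGraph n → Fin n → Bool
isLeafᵇ G x with deg G x
... | 1 = true
... | _ = false

Leaf : ∀ {n} → BGraph n → Fin n → Set
Leaf G x = deg G x ≡ 1

leaves : ∀ {n} → BGraph n → List (Fin n)
leaves {n} G = filterᵇ (isLeafᵇ G) (allFin n)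

-- Plane embeddings of a tree = rotation systems.
-- rot v : the cyclic successor (around v) of each neighbour of v.
-- Condition: rot v maps neighbours of v to neighbours of v, and it acts
-- as a single cyclic permutation on N(v).

iter : ∀ {A : Set} → ℕ → (A → A) → A → A
iter zero    f a = a
iter (suc k) f a = f (iter k f a)

IsRotationSystem : ∀ {n} → BGraph n → (Fin n → Fin n → Fin n) → Set
IsRotationSystem G rot =
  (∀ v u → Adj G v u → Adj G v (rot v u))
  × (∀ v u w → Adj G v u → Adj G v w → ∃[ k ] iter k (rot v) u ≡ w)

-- facial walk of the embedded tree on darts (u , v) (u → v):
-- after arriving at v from u, leave v along the next edge around v.
faceStep : ∀ {n} → (Fin n → Fin n → Fin n) → Fin n × Fin n → Fin n × Fin n
faceStep rot (u , v) = (v , rot v u)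

-- y is the leaf following the leaf x along the boundary walk of the
-- (unique) face of the embedded tree.
NextLeaf : ∀ {n} → BGraph n → (Fin n → Fin n → Fin n) → Fin n → Fin n → Set
NextLeaf G rot x y =
  Leaf G x × Leaf G y ×
  Σ (Fin _) λ p → Adj G p x ×
    Σ ℕ λ k → 1 ≤ k
      × proj₂ (iter k (faceStep rot) (p , x)) ≡ y
      × (∀ j → 1 ≤ j → j < k → ¬ Leaf G (proj₂ (iter j (faceStep rot) (p , x))))

CAdj : ∀ {n} → BGraph n → (Fin n → Fin n → Fin n) → Rel n
CAdj G rot x y = NextLeaf G rot x y ⊎ NextLeaf G rot y x

HalinAdj : ∀ {n} → BGraph n → (Fin n → Fin n → Fin n) → Rel n
HalinAdj G rot x y = Adj G x y ⊎ CAdj G rot x y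

-- (T, rot) determines a Halin graph: T a tree without degree-2 vertices,
-- rot a plane embedding of T, and C (through the ≥ 3 leaves) a cycle.
IsHalinData : ∀ {n} → BGraph n → (Fin n → Fin n → Fin n) → Set
IsHalinData G rot =
  IsTree G × (∀ v → deg G v ≢ 2) × IsRotationSystem G rot
  × 3 ≤ length (leaves G)

IsComplete : ∀ {n} → BGraph n → Set
IsComplete G = Σ (Fin _) λ r → Σ ℕ λ d → ∀ x → Leaf G x → Dist (Adj G) r x d

-- Star edge colourings.  A colouring is a function on ordered pairs,
-- required to be symmetric on edges (so it is a function on edges).

EdgeFun : ∀ {n} → Rel n → (Fin n → Fin n → ℕ) → Set
EdgeFun E φ = ∀ x y → E x y → φ x y ≡ φ y x

Proper : ∀ {n} → Rel n → (Fin n → Fin n → ℕ) → Set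
Proper E φ = ∀ u v w → E u v → E u w → v ≢ w → φ u v ≢ φ u w

-- v0 v1 v2 v3 v4 is a path of length 4 (all distinct) or a cycle of
-- length 4 (v0..v3 distinct, v4 = v0)
PathOrCycle4 : ∀ {n} → Rel n → Fin n → Fin n → Fin n → Fin n → Fin n → Set
PathOrCycle4 E v₀ v₁ v₂ v₃ v₄ =
  E v₀ v₁ × E v₁ v₂ × E v₂ v₃ × E v₃ v₄
  × v₀ ≢ v₁ × v₀ ≢ v₂ × v₀ ≢ v₃
  × v₁ ≢ v₂ × v₁ ≢ v₃ × v₁ ≢ v₄
  × v₂ ≢ v₃ × v₂ ≢ v₄ × v₃ ≢ v₄

Bichromatic4 : ∀ {n} → (Fin n → Fin n → ℕ) → Fin n → Fin n → Fin n → Fin n → Fin n → Set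
Bichromatic4 φ v₀ v₁ v₂ v₃ v₄ = Σ ℕ λ a → Σ ℕ λ b →
  (φ v₀ v₁ ≡ a ⊎ φ v₀ v₁ ≡ b) × (φ v₁ v₂ ≡ a ⊎ φ v₁ v₂ ≡ b)
  × (φ v₂ v₃ ≡ a ⊎ φ v₂ v₃ ≡ b) × (φ v₃ v₄ ≡ a ⊎ φ v₃ v₄ ≡ b)

IsStarEdgeColouring : ∀ {n} → Rel n → (Fin n → Fin n → ℕ) → Set
IsStarEdgeColouring E φ =
  EdgeFun E φ × Proper E φ
  × (∀ v₀ v₁ v₂ v₃ v₄ → PathOrCycle4 E v₀ v₁ v₂ v₃ v₄ → ¬ Bichromatic4 φ v₀ v₁ v₂ v₃ v₄)

-- list assignments to edges (lists of distinct colours = finite sets)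
ListAssignment : ∀ {n} → Rel n → ℕ → (Fin n → Fin n → List ℕ) → Set
ListAssignment E k L =
  (∀ x y → E x y → L x y ≡ L y x)
  × (∀ x y → E x y → Unique (L x y) × k ≤ length (L x y))

-- star k-edge choosable  (equivalently ch'_star ≤ k)
StarEdgeChoosable : ∀ {n} → Rel n → ℕ → Set
StarEdgeChoosable {n} E k =
  ∀ (L : Fin n → Fin n → List ℕ) → ListAssignment E k L →
    Σ (Fin n → Fin n → ℕ) λ φ → IsStarEdgeColouring E φ × (∀ x y → E x y → φ x y ∈ L x y)

halinBound : ∀ {n} → BGraph n → ℕ
halinBound T = ((θ T + Δ T) / 2) ⊔ (2 * (Δ T / 2) + 6)

{-# OPTIONS --safe #-}
-- Every edge is coloured greedily, in an order in which each edge has fewer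
-- than halinBound T conflicts with earlier ones.
--
-- Tree edges.  Let m have degree D.  For any two neighbours x, z of m it is
-- enough to keep either the colour of mz away from the other edges at x or the
-- colour of mx away from the other edges at z.  Each x takes charge of the ⌊D/2⌋
-- neighbours that follow it around m, which covers all pairs.  A child edge of
-- x then avoids at most ⌊D/2⌋ colours besides those of the other edges at x; the
-- edges from m to the at most ⌊D/2⌋ children of which the parent of m takes
-- charge are coloured first and avoid all colours at that parent.  Both counts
-- are covered by deg x + ⌊deg y / 2⌋ ≤ ⌊(θ + Δ) / 2⌋ for adjacent x, y.
--
-- Cycle edges.  All children of the parent v of a leaf are leaves, and they are
-- consecutive on the cycle: the facial walk from the last of them climbs to an
-- ancestor of v and descends elsewhere.  The order of colouring is: inner tree
-- edges, cycle edges between different parents (crossing edges), pendant edges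
-- (in each group the two at either end first), remaining cycle edges.  A
-- non-crossing edge avoids all colours at the parent of its ends and four more,
-- which Δ + 5 ≤ halinBound T allows; the pendant edges near the ends of a group
-- avoid the two crossing edges of that group.

module Submission where

open import Defs renaming (sym to adj-sym; irrefl to adj-irrefl)
open import Data.Bool using (true; T; if_then_else_)
import Data.Bool.Properties as Bool
open import Data.Empty using (⊥-elim)
open import Data.Fin as Fin using (Fin; toℕ)
import Data.Fin.Properties as Fin
open import Data.List using (List; []; _∷_; _++_; length; map; filter; filterᵇ; allFin; upTo; last; lookup)
import Data.List.Properties as List
open import Data.List.Membership.Propositional using (_∈_; _∉_)
open import Data.List.Membership.Propositional.Properties
open import Data.List.Relation.Unary.All as All using (All; []; _∷_)
import Data.List.Relation.Unary.All.Properties as All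
open import Data.List.Relation.Unary.AllPairs using ([]; _∷_)
open import Data.List.Relation.Unary.Any as Any using (here; there; index)
open import Data.List.Relation.Unary.Any.Properties using (lookup-index)
open import Data.List.Relation.Unary.Linked as Linked using (Linked; []; [-]; _∷_)
open import Data.List.Relation.Unary.Unique.Propositional using (Unique)
import Data.List.Relation.Unary.Unique.Propositional.Properties as Unique
open import Data.Maybe using (just)
open import Data.Nat using (ℕ; zero; suc; _+_; _*_; _∸_; _≤_; _<_; z≤n; s≤s; _≤?_; _<?_)
open import Data.Nat.DivMod using (_/_; _%_; m≡m%n+[m/n]*n; m%n<n; /-monoˡ-≤; +-distrib-/-∣ˡ; m*n/n≡m)
open import Data.Nat.Divisibility using (divides-refl)
open import Data.Nat.Properties
open import Data.Product using (Σ; ∃; ∃-syntax; _×_; _,_; proj₁; proj₂)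
open import Data.Sum using (_⊎_; inj₁; inj₂)
open import Function using (_∘_; id; flip)
open import Relation.Binary.Definitions using (tri<; tri≈; tri>)
open import Relation.Binary.PropositionalEquality using (_≡_; _≢_; refl; sym; trans; cong; cong₂; subst; subst₂; ≢-sym)
open import Relation.Nullary using (¬_; Dec; yes; no; contradiction)
open import Relation.Nullary.Decidable using (¬?; _×-dec_; map′; decidable-stable)

-- Lists, choice and iteration.

private variable
  A : Set

unique⊆⇒length≤ : {xs ys : List A} → Unique xs → (∀ {x} → x ∈ xs → x ∈ ys) →
                  length xs ≤ length ys
unique⊆⇒length≤ {xs = []}     _         _   = z≤n
unique⊆⇒length≤ {A = A} {xs = x ∷ xs} {ys} (x∉ ∷ uxs) sub
  with as , bs , refl ← ∈-∃++ (sub (here refl)) = begin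
    suc (length xs)               ≤⟨ s≤s (unique⊆⇒length≤ uxs sub′) ⟩
    suc (length (as ++ bs))       ≡⟨ cong suc (List.length-++ as) ⟩
    suc (length as + length bs)   ≡⟨ +-suc (length as) (length bs) ⟨
    length as + suc (length bs)   ≡⟨ List.length-++ as ⟨
    length (as ++ x ∷ bs)         ∎
  where
  open ≤-Reasoning
  sub′ : ∀ {z} → z ∈ xs → z ∈ as ++ bs
  sub′ z∈ with ∈-++⁻ as (sub (there z∈))
  ... | inj₁ z∈as         = ∈-++⁺ˡ z∈as
  ... | inj₂ (here refl)  = contradiction refl (All.lookup x∉ z∈)
  ... | inj₂ (there z∈bs) = ∈-++⁺ʳ as z∈bs

-- The default 0 is harmless: by `pick-spec` it is not reached when `xs` has no repetitions and is
-- longer than `fs`.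
pick : List ℕ → List ℕ → ℕ
pick []       fs = 0
pick (x ∷ xs) fs with Any.any? (x ≟_) fs
... | yes _ = pick xs fs
... | no  _ = x

pick-spec′ : ∀ xs fs → (pick xs fs ∈ xs × pick xs fs ∉ fs) ⊎ (∀ {x} → x ∈ xs → x ∈ fs)
pick-spec′ []       fs = inj₂ λ ()
pick-spec′ (x ∷ xs) fs with Any.any? (x ≟_) fs
... | no x∉ = inj₁ (here refl , x∉)
... | yes x∈ with pick-spec′ xs fs
...   | inj₁ (p , q) = inj₁ (there p , q)
...   | inj₂ sub     = inj₂ λ { (here refl) → x∈ ; (there i) → sub i }

pick-spec : ∀ {xs fs} → Unique xs → length fs < length xs →
            pick xs fs ∈ xs × pick xs fs ∉ fs
pick-spec {xs} {fs} u lt with pick-spec′ xs fs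
... | inj₁ p   = p
... | inj₂ sub = contradiction (unique⊆⇒length≤ u sub) (<⇒≱ lt)

maxList-≥ : ∀ {x} xs → x ∈ xs → x ≤ maxList xs
maxList-≥ (y ∷ ys) (here refl) = m≤m⊔n y _
maxList-≥ (y ∷ ys) (there i)   = ≤-trans (maxList-≥ ys i) (m≤n⊔m y _)

iter-suc : ∀ k (f : A → A) x → iter k f (f x) ≡ f (iter k f x)
iter-suc zero    f x = refl
iter-suc (suc k) f x = cong f (iter-suc k f x)

iter-+ : ∀ i j (f : A → A) x → iter (i + j) f x ≡ iter i f (iter j f x)
iter-+ zero    j f x = refl
iter-+ (suc i) j f x = cong f (iter-+ i j f x)

iter-period : ∀ k q (f : A → A) {x} → iter q f x ≡ x → iter (k * q) f x ≡ x
iter-period zero    q f e = refl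
iter-period (suc k) q f e =
  trans (iter-+ q (k * q) f _) (trans (cong (iter q f) (iter-period k q f e)) e)

least : {P : ℕ → Set} → (∀ ℓ → Dec (P ℓ)) → ∀ {k} → P k →
        ∃[ ℓ ] P ℓ × (∀ {j} → P j → ℓ ≤ j)
least {P} P? {k} pk = go k P? pk
  where
  go : ∀ k {P : ℕ → Set} → (∀ ℓ → Dec (P ℓ)) → P k → ∃[ ℓ ] P ℓ × (∀ {j} → P j → ℓ ≤ j)
  go zero    P? p = 0 , p , λ _ → z≤n
  go (suc k) P? p with P? 0
  ... | yes p₀ = 0 , p₀ , λ _ → z≤n
  ... | no ¬p₀ with go k (P? ∘ suc) p
  ...   | ℓ , pℓ , min = suc ℓ , pℓ , λ { {zero} p₀ → contradiction p₀ ¬p₀ ; {suc j} pj → s≤s (min pj) }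

pigeonhole-∈ : (xs : List A) (g : ℕ → A) → (∀ i → g i ∈ xs) →
               ∃[ i ] ∃[ j ] i < j × j ≤ length xs × g i ≡ g j
pigeonhole-∈ xs g g∈ with Fin.pigeonhole (n<1+n (length xs)) (λ i → index (g∈ (toℕ i)))
... | i , j , i<j , e = toℕ i , toℕ j , i<j , Fin.toℕ≤pred[n] j ,
  trans (lookup-index (g∈ (toℕ i))) (trans (cong (lookup xs) e) (sym (lookup-index (g∈ (toℕ j)))))

-- Maps acting transitively on a finite list.

module Orbit (f : A → A) (xs : List A)
             (closed : ∀ {x} → x ∈ xs → f x ∈ xs) where

  iter-∈ : ∀ k {x} → x ∈ xs → iter k f x ∈ xs
  iter-∈ zero    x∈ = x∈
  iter-∈ (suc k) x∈ = closed (iter-∈ k x∈)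

  module Transitive (reach : ∀ {x y} → x ∈ xs → y ∈ xs → ∃[ k ] iter k f x ≡ y) where

    -- By pigeonhole two iterates `i < j` agree, so `j ∸ i` is a period of the `i`-th iterate. Some
    -- power of `f` carries that iterate back to `x` and commutes with `f`, so `j ∸ i` is a period
    -- of `x` too.
    period : ∀ {x} → x ∈ xs → ∃[ q ] 1 ≤ q × q ≤ length xs × iter q f x ≡ x
    period {x} x∈ with pigeonhole-∈ xs (λ i → iter i f x) (λ i → iter-∈ i x∈)
    ... | i , j , i<j , j≤ , e with reach (iter-∈ i x∈) x∈
    ... | l , back = j ∸ i , m<n⇒0<n∸m i<j , ≤-trans (m∸n≤m j i) j≤ ,
      trans (cong (iter (j ∸ i) f) (sym back))
        (trans (sym (iter-+ (j ∸ i) l f _))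
          (trans (cong (λ m → iter m f (iter i f x)) (+-comm (j ∸ i) l))
            (trans (iter-+ l (j ∸ i) f _)
              (trans (cong (iter l f) (sym (iter-+ (j ∸ i) i f x)))
                (trans (cong (λ m → iter l f (iter m f x)) (m∸n+n≡m (<⇒≤ i<j)))
                  (trans (cong (iter l f) (sym e)) back))))))

    period-all : ∀ {x y q} → x ∈ xs → y ∈ xs → iter q f x ≡ x → iter q f y ≡ y
    period-all {x} {y} {q} x∈ y∈ e with reach x∈ y∈
    ... | k , refl = trans (sym (iter-+ q k f x))
      (trans (cong (λ m → iter m f x) (+-comm q k))
        (trans (iter-+ k q f x) (cong (iter k f) e)))

    surjective : ∀ {y} → y ∈ xs → ∃[ x ] x ∈ xs × f x ≡ y
    surjective y∈ with period y∈
    ... | suc q , _ , _ , e = _ , iter-∈ q y∈ , e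

    -- The steps that complete a period undo `f`, and by `period-all` the same number of steps
    -- serves `x` and `y`.
    injective : ∀ {x y} → x ∈ xs → y ∈ xs → f x ≡ f y → x ≡ y
    injective {x} {y} x∈ y∈ e with period x∈
    ... | suc q , _ , _ , per =
      trans (sym per) (trans (sym (iter-suc q f x))
        (trans (cong (iter q f) e) (trans (iter-suc q f y) (period-all {q = suc q} x∈ y∈ per))))

    orbit-list : ∀ {x y} q → 1 ≤ q → x ∈ xs → iter q f x ≡ x → y ∈ xs →
                 ∃[ i ] i < q × iter i f x ≡ y
    orbit-list {x} (suc q) _ x∈ per y∈ with reach x∈ y∈
    ... | k , e = k % suc q , m%n<n k (suc q) , trans (sym mod) e
      where
      mod : iter k f x ≡ iter (k % suc q) f x
      mod = trans (cong (λ m → iter m f x) (m≡m%n+[m/n]*n k (suc q)))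
        (trans (iter-+ (k % suc q) _ f x) (cong (iter (k % suc q) f) (iter-period (k / suc q) (suc q) f per)))

    no-fix : ∀ {x} → Unique xs → 2 ≤ length xs → x ∈ xs → f x ≢ x
    no-fix {x} u two x∈ e = <⇒≱ two (unique⊆⇒length≤ {ys = x ∷ []} u all)
      where
      all : ∀ {y} → y ∈ xs → y ∈ x ∷ []
      all y∈ with orbit-list 1 ≤-refl x∈ e y∈
      ... | zero  , _       , r = here (sym r)
      ... | suc _ , s≤s ()  , _

    no-2-cycle : ∀ {x} → Unique xs → 3 ≤ length xs → x ∈ xs → f (f x) ≢ x
    no-2-cycle {x} u three x∈ e = <⇒≱ three (unique⊆⇒length≤ {ys = x ∷ f x ∷ []} u all)
      where
      all : ∀ {y} → y ∈ xs → y ∈ x ∷ f x ∷ []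
      all y∈ with orbit-list 2 (s≤s z≤n) x∈ e y∈
      ... | 0 , _ , r = here (sym r)
      ... | 1 , _ , r = there (here (sym r))
      ... | suc (suc _) , s≤s (s≤s ()) , _

    ahead : A → List A
    ahead x = map (λ j → iter (suc j) f x) (upTo (length xs / 2))

    length-ahead : ∀ x → length (ahead x) ≡ length xs / 2
    length-ahead x = trans (List.length-map _ (upTo (length xs / 2))) (List.length-upTo _)

    ahead-∈ : ∀ {x y} i → i < length xs / 2 → iter (suc i) f x ≡ y → y ∈ ahead x
    ahead-∈ i i< refl = ∈-map⁺ _ (∈-upTo⁺ i<)

    -- The shorter of the two arcs between x and y on the cycle of f has at
    -- most half of the elements.
    ahead-total : ∀ {x y} → x ∈ xs → y ∈ xs → x ≢ y → y ∈ ahead x ⊎ x ∈ ahead y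
    ahead-total {x} {y} x∈ y∈ x≢y with period x∈
    ... | q , 1≤q , q≤ , per with orbit-list q 1≤q x∈ per y∈
    ... | zero  , _   , e = contradiction e x≢y
    ... | suc i , i<q , e with suc i ≤? length xs / 2
    ...   | yes i<h = inj₁ (ahead-∈ i i<h e)
    ...   | no ¬i<h = inj₂ (ahead-∈ (q ∸ suc (suc i)) bound back)
      where
      q≡ : q ∸ suc i ≡ suc (q ∸ suc (suc i))
      q≡ = +-∸-assoc 1 {q} {suc (suc i)} i<q
      back : iter (suc (q ∸ suc (suc i))) f y ≡ x
      back = trans (cong (λ m → iter m f y) (sym q≡)) (trans (cong (iter (q ∸ suc i) f) (sym e))
        (trans (sym (iter-+ (q ∸ suc i) (suc i) f x)) (trans (cong (λ m → iter m f x) (m∸n+n≡m (<⇒≤ i<q))) per)))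
      D = length xs
      h = D / 2
      D≤ : D ≤ 1 + h + h
      D≤ = begin
        D                  ≡⟨ m≡m%n+[m/n]*n D 2 ⟩
        D % 2 + h * 2      ≤⟨ +-mono-≤ (≤-pred (m%n<n D 2)) (≤-reflexive (trans (*-comm h 2) (cong (h +_) (+-identityʳ h)))) ⟩
        1 + (h + h)        ∎
        where open ≤-Reasoning
      bound : q ∸ suc (suc i) < h
      bound = subst (_≤ h) q≡ (begin
        q ∸ suc i          ≤⟨ ∸-mono q≤ (≰⇒> ¬i<h) ⟩
        D ∸ suc h          ≤⟨ ∸-monoˡ-≤ (suc h) D≤ ⟩
        1 + h + h ∸ suc h  ≡⟨ m+n∸m≡n (suc h) h ⟩
        h                  ∎)
        where open ≤-Reasoning

-- Some positive iterate of the injection f fixes y, and its predecessor under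
-- f is the preimage of y.
module Permutation {N : ℕ} (P : Fin N → Set) (f : Fin N → Fin N) (closed : ∀ {x} → P x → P (f x))
                   (f-inj : ∀ {x y} → P x → P y → f x ≡ f y → x ≡ y) where

  iter-P : ∀ k {x} → P x → P (iter k f x)
  iter-P zero    p = p
  iter-P (suc k) p = closed (iter-P k p)

  preimage : ∀ {y} → P y → ∃[ x ] P x × f x ≡ y
  preimage {y} py with pigeonhole-∈ (allFin N) (λ i → iter i f y) (λ i → ∈-allFin _)
  ... | i , j , i<j , _ , e = iter (j ∸ suc i) f y , iter-P (j ∸ suc i) py ,
        trans (cong (λ m → iter m f y) (sym (+-∸-assoc 1 {j} {suc i} i<j))) (sym (cancel i (j ∸ i) (trans e (cong (λ m → iter m f y) (sym (m+[n∸m]≡n (<⇒≤ i<j)))))))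
    where
    cancel : ∀ i l → iter i f y ≡ iter (i + l) f y → y ≡ iter l f y
    cancel zero    l e = e
    cancel (suc i) l e = cancel i l (f-inj (iter-P i py) (iter-P (i + l) py) e)

-- Walks and simple paths.

simple-suffix : {R : A → A → Set} {x : A} {y z : A} → ∀ xs → x ∈ (z ∷ xs) →
                Unique (z ∷ xs) → Linked R (z ∷ xs) → last (z ∷ xs) ≡ just y →
                ∃[ ys ] Unique (x ∷ ys) × Linked R (x ∷ ys) × last (x ∷ ys) ≡ just y
simple-suffix xs       (here refl)       u       l       e = xs , u , l , e
simple-suffix (_ ∷ xs) (there x∈) (_ ∷ u) (_ ∷ l) e = simple-suffix xs x∈ u l e

-- Loops are erased from the far end: if `x` already lies on the path obtained from the rest of the
-- walk, only the part from `x` on is kept.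
simple-path : ∀ {n} {E : Rel n} {x y} → Walk E x y →
              ∃[ xs ] Unique (x ∷ xs) × Linked E (x ∷ xs) × last (x ∷ xs) ≡ just y
simple-path [] = [] , ([] ∷ []) , [-] , refl
simple-path {x = x} (_∷_ {v = v} e w) with simple-path w
... | xs , u , l , la with Any.any? (x Fin.≟_) (v ∷ xs)
...   | yes x∈ = simple-suffix xs x∈ u l la
...   | no  x∉ = v ∷ xs , All.¬Any⇒All¬ _ x∉ ∷ u , e ∷ l , la

_++ʷ_ : ∀ {n} {E : Rel n} {x y z} → Walk E x y → Walk E y z → Walk E x z
[]      ++ʷ w′ = w′
(e ∷ w) ++ʷ w′ = e ∷ (w ++ʷ w′)

reverseʷ : ∀ {n} {E : Rel n} → (∀ {x y} → E x y → E y x) → ∀ {x y} → Walk E x y → Walk E y x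
reverseʷ s []      = []
reverseʷ s (e ∷ w) = reverseʷ s w ++ʷ (s e ∷ [])

-- Neighbours and degrees.

module Neighbours {N : ℕ} (G : BGraph N) where

  ∼-sym : ∀ {x y} → Adj G x y → Adj G y x
  ∼-sym {x} {y} e = trans (sym (adj-sym G x y)) e

  ∼-irrefl : ∀ {x} → ¬ Adj G x x
  ∼-irrefl {x} e with trans (sym e) (adj-irrefl G x)
  ... | ()

  ∼-≢ : ∀ {x y} → Adj G x y → x ≢ y
  ∼-≢ e refl = ∼-irrefl e

  ∼-dec : ∀ x y → Dec (Adj G x y)
  ∼-dec x y = adj G x y Bool.≟ true

  nbrs : Fin N → List (Fin N)
  nbrs x = filterᵇ (adj G x) (allFin N)

  T⁺ : ∀ {b} → b ≡ true → T b
  T⁺ refl = _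

  T⁻ : ∀ {b} → T b → b ≡ true
  T⁻ {true} _ = refl

  ∈-nbrs⁺ : ∀ {x y} → Adj G x y → y ∈ nbrs x
  ∈-nbrs⁺ {x} {y} e = ∈-filter⁺ (λ z → Bool.T? (adj G x z)) (∈-allFin y) (T⁺ e)

  ∈-nbrs⁻ : ∀ {x y} → y ∈ nbrs x → Adj G x y
  ∈-nbrs⁻ {x} y∈ = T⁻ (proj₂ (∈-filter⁻ (λ z → Bool.T? (adj G x z)) {xs = allFin N} y∈))

  nbrs-unique : ∀ x → Unique (nbrs x)
  nbrs-unique x = Unique.filter⁺ (λ z → Bool.T? (adj G x z)) (Unique.allFin⁺ N)

  deg-positive : ∀ {x y} → Adj G x y → 1 ≤ deg G x
  deg-positive e = ∈-length (∈-nbrs⁺ e)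

  leaf-nbr-unique : ∀ {x y z} → Leaf G x → Adj G x y → Adj G x z → y ≡ z
  leaf-nbr-unique {x} l e e′ with nbrs x | ∈-nbrs⁺ e | ∈-nbrs⁺ e′ | l
  ... | _ ∷ [] | here refl | here refl | _ = refl

  deg≤Δ : ∀ x → deg G x ≤ Δ G
  deg≤Δ x = maxList-≥ _ (∈-map⁺ (deg G) (∈-allFin x))

  deg+deg≤θ : ∀ {x y} → Adj G x y → deg G x + deg G y ≤ θ G
  deg+deg≤θ {x} {y} e = maxList-≥ _ (∈-concatMap⁺ _ (lose-allFin x (subst (_∈ map f (allFin N)) eq (∈-map⁺ f (∈-allFin y)))))
    where
    lose-allFin : ∀ {P : Fin N → Set} x → P x → Any.Any P (allFin N)
    lose-allFin x p = Any.map (λ { refl → p }) (∈-allFin x)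
    f : Fin N → ℕ
    f z = if adj G x z then deg G x + deg G z else 0
    eq : f y ≡ deg G x + deg G y
    eq rewrite e = refl

-- Depth and parents in a rooted tree.

module RootedTree {N : ℕ} (T : BGraph N) (tree : IsTree T) (r : Fin N) where
  open Neighbours T

  -- Walks to the root indexed by length: existence at a given length is decidable, so the least
  -- length can be searched for.
  data Climb : ℕ → Fin N → Set where
    stop : Climb 0 r
    up   : ∀ {ℓ x y} → Adj T x y → Climb ℓ y → Climb (suc ℓ) x

  climb? : ∀ x ℓ → Dec (Climb ℓ x)
  climb? x zero    = map′ (λ { refl → stop }) (λ { stop → refl }) (x Fin.≟ r)
  climb? x (suc ℓ) = map′ (λ { (_ , e , c) → up e c }) (λ { (up e c) → _ , e , c })
                          (Fin.any? λ y → ∼-dec x y ×-dec climb? y ℓ)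

  walk⇒climb : ∀ {x} (w : Walk (Adj T) x r) → Climb (walkLength w) x
  walk⇒climb []      = stop
  walk⇒climb (e ∷ w) = up e (walk⇒climb w)

  shortest : ∀ x → ∃[ ℓ ] Climb ℓ x × (∀ {j} → Climb j x → ℓ ≤ j)
  shortest x = least (climb? x) (walk⇒climb (proj₁ tree x r))

  abstract
    dep : Fin N → ℕ
    dep x = proj₁ (shortest x)

    dep-climb : ∀ x → Climb (dep x) x
    dep-climb x = proj₁ (proj₂ (shortest x))

    dep-min : ∀ {x j} → Climb j x → dep x ≤ j
    dep-min {x} = proj₂ (proj₂ (shortest x))

  dep-≤-suc : ∀ {x y} → Adj T x y → dep x ≤ suc (dep y)
  dep-≤-suc e = dep-min (up e (dep-climb _))

  dep-r : dep r ≡ 0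
  dep-r = n≤0⇒n≡0 (dep-min stop)

  dep-0 : ∀ {x} → dep x ≡ 0 → x ≡ r
  dep-0 {x} e with dep x | dep-climb x
  dep-0 refl | _ | stop = refl

  private
    parent : ∀ x → x ≢ r → ∃[ y ] Adj T x y × dep x ≡ suc (dep y)
    parent x x≢r = go (dep x) (dep-climb x) refl
      where
      go : ∀ ℓ → Climb ℓ x → dep x ≡ ℓ → ∃[ y ] Adj T x y × dep x ≡ suc (dep y)
      go _ stop     _  = contradiction refl x≢r
      go _ (up e c) eq = _ , e , ≤-antisym (dep-≤-suc e) (subst (suc _ ≤_) (sym eq) (s≤s (dep-min c)))

  abstract
    -- The root is its own parent by convention. As no vertex is adjacent to itself, `par r` is
    -- never mistaken for a neighbour of `r`.
    par : Fin N → Fin N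
    par x with x Fin.≟ r
    ... | yes _   = r
    ... | no  x≢r = proj₁ (parent x x≢r)

    par-r : par r ≡ r
    par-r with r Fin.≟ r
    ... | yes _   = refl
    ... | no  r≢r = contradiction refl r≢r

    par-∼ : ∀ {x} → x ≢ r → Adj T x (par x)
    par-∼ {x} x≢r with x Fin.≟ r
    ... | yes x≡r = contradiction x≡r x≢r
    ... | no  p   = proj₁ (proj₂ (parent x p))

    dep-par : ∀ {x} → x ≢ r → dep x ≡ suc (dep (par x))
    dep-par {x} x≢r with x Fin.≟ r
    ... | yes x≡r = contradiction x≡r x≢r
    ... | no  p   = proj₂ (proj₂ (parent x p))

  private
    Avoiding : Fin N → Rel N
    Avoiding v x y = Adj T x y × x ≢ v × y ≢ v

    -- All vertices after `u` on the way up are less deep than `v`, so following parents never meets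
    -- `v`.
    ascend : ∀ {v u} ℓ → dep u ≡ ℓ → dep u ≤ dep v → u ≢ v → Walk (Avoiding v) u r
    ascend zero    e _  _   with refl ← dep-0 e = []
    ascend {v} {u} (suc ℓ) e le u≢v = (par-∼ u≢r , u≢v , p≢v) ∷ ascend ℓ eq (<⇒≤ lt) p≢v
      where
      u≢r : u ≢ r
      u≢r refl with trans (sym dep-r) e
      ... | ()
      eq : dep (par u) ≡ ℓ
      eq = suc-injective (trans (sym (dep-par u≢r)) e)
      lt : dep (par u) < dep v
      lt = subst (_≤ dep v) (dep-par u≢r) le
      p≢v : par u ≢ v
      p≢v p = <-irrefl (cong dep p) lt

    avoiding-all : ∀ {v x y} xs → Linked (Avoiding v) (x ∷ y ∷ xs) → All (v ≢_) (x ∷ y ∷ xs)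
    avoiding-all []       ((_ , p , q) ∷ _) = ≢-sym p ∷ ≢-sym q ∷ []
    avoiding-all (_ ∷ xs) ((_ , p , _) ∷ l) = ≢-sym p ∷ avoiding-all xs l

  -- Two such neighbours would be joined through the root by a path avoiding
  -- v, which closes up to a cycle at v.
  one-nbr-above : ∀ {v u u′} → Adj T v u → Adj T v u′ → dep u ≤ dep v → dep u′ ≤ dep v → u ≡ u′
  one-nbr-above {v} {u} {u′} e e′ le le′ with u Fin.≟ u′
  ... | yes p = p
  ... | no u≢u′ with simple-path (ascend _ refl le (≢-sym (∼-≢ e)) ++ʷ
                       reverseʷ (λ (a , b , c) → ∼-sym a , c , b) (ascend _ refl le′ (≢-sym (∼-≢ e′))))
  ...   | []     , _ , _ , refl = contradiction refl u≢u′
  ...   | x ∷ xs , un , li , la = ⊥-elim (proj₂ tree (v ∷ u ∷ x ∷ xs)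
            ( avoiding-all xs li ∷ un
            , e ∷ Linked.map proj₁ li
            , u′ , la , ∼-sym e′ ))

  -- The deeper end (`x` on a tie) has its parent and the other end as neighbours that are no deeper
  -- than itself; `one-nbr-above` identifies them.
  par-or-child : ∀ {x y} → Adj T x y → (x ≢ r × par x ≡ y) ⊎ (y ≢ r × par y ≡ x)
  par-or-child {x} {y} e with dep y ≤? dep x
  ... | no ¬le = inj₂ (y≢r , one-nbr-above (par-∼ y≢r) (∼-sym e) (subst (dep (par y) ≤_) (sym (dep-par y≢r)) (n≤1+n _)) (<⇒≤ (≰⇒> ¬le)))
    where
    y≢r : y ≢ r
    y≢r refl = ¬le (subst (_≤ dep x) (sym dep-r) z≤n)
  ... | yes le = inj₁ (x≢r , one-nbr-above (par-∼ x≢r) e (subst (dep (par x) ≤_) (sym (dep-par x≢r)) (n≤1+n _)) le)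
    where
    x≢r : x ≢ r
    x≢r refl = ∼-≢ e (sym (dep-0 (n≤0⇒n≡0 (subst (dep y ≤_) dep-r le))))

  child : ∀ {x y} → Adj T x y → y ≢ par x → y ≢ r × par y ≡ x
  child e y≢ with par-or-child e
  ... | inj₁ (_ , p) = contradiction (sym p) y≢
  ... | inj₂ c       = c

  nbr-of-r : ∀ {y} → Adj T r y → y ≢ par r
  nbr-of-r e p = ∼-irrefl (subst (Adj T r) (trans p par-r) e)

  par-∼′ : ∀ {x} → x ≢ r → Adj T (par x) x
  par-∼′ x≢r = ∼-sym (par-∼ x≢r)

  dep-child : ∀ {x} → x ≢ r → dep (par x) < dep x
  dep-child x≢r = ≤-reflexive (sym (dep-par x≢r))

  par-antisym : ∀ {x y} → x ≢ r → y ≢ r → par x ≡ y → par y ≢ x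
  par-antisym {x} x≢r y≢r refl p =
    <-asym (dep-child x≢r) (subst (λ z → dep z < dep (par x)) p (dep-child y≢r))

-- Leaves and depth in a complete Halin graph.

module Halin {N : ℕ} (T : BGraph N) (rot : Fin N → Fin N → Fin N) (halin : IsHalinData T rot)
             (r : Fin N) (d : ℕ) (complete : ∀ x → Leaf T x → Dist (Adj T) r x d) where
  open Neighbours T public
  open RootedTree T (proj₁ halin) r public

  leaf? : ∀ x → Dec (Leaf T x)
  leaf? x = deg T x ≟ 1

  private
    rotSystem : IsRotationSystem T rot
    rotSystem = proj₁ (proj₂ (proj₂ halin))

  rot-∼ : ∀ {v u} → Adj T v u → Adj T v (rot v u)
  rot-∼ = proj₁ rotSystem _ _

  private
    module Around v = Orbit (rot v) (nbrs v) (λ u∈ → ∈-nbrs⁺ (rot-∼ (∈-nbrs⁻ u∈)))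
    module Cyclic v = Around.Transitive v (λ u∈ w∈ → proj₂ rotSystem v _ _ (∈-nbrs⁻ u∈) (∈-nbrs⁻ w∈))

  rot-injective : ∀ {v x y} → Adj T v x → Adj T v y → rot v x ≡ rot v y → x ≡ y
  rot-injective e e′ = Cyclic.injective _ (∈-nbrs⁺ e) (∈-nbrs⁺ e′)

  rot-surjective : ∀ {v y} → Adj T v y → ∃[ x ] Adj T v x × rot v x ≡ y
  rot-surjective e with Cyclic.surjective _ (∈-nbrs⁺ e)
  ... | x , x∈ , eq = x , ∈-nbrs⁻ x∈ , eq

  -- The half of the neighbours of v that follow x around v.
  ahead : Fin N → Fin N → List (Fin N)
  ahead v = Cyclic.ahead v

  length-ahead : ∀ v x → length (ahead v x) ≡ deg T v / 2
  length-ahead v x = Cyclic.length-ahead v x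

  ahead-total : ∀ {v x y} → Adj T v x → Adj T v y → x ≢ y → y ∈ ahead v x ⊎ x ∈ ahead v y
  ahead-total e e′ = Cyclic.ahead-total _ (∈-nbrs⁺ e) (∈-nbrs⁺ e′)

  leaf∈leaves : ∀ {x} → x ∈ leaves T → Leaf T x
  leaf∈leaves {x} x∈ = lem (T⁻ (proj₂ (∈-filter⁻ (λ z → Bool.T? (isLeafᵇ T z)) {xs = allFin N} x∈)))
    where
    lem : isLeafᵇ T x ≡ true → Leaf T x
    lem e with deg T x
    lem () | 0
    lem e  | 1 = refl
    lem () | suc (suc _)

  leaves-unique : Unique (leaves T)
  leaves-unique = Unique.filter⁺ (λ z → Bool.T? (isLeafᵇ T z)) (Unique.allFin⁺ N)

  private
    climb-along : ∀ {x y ℓ} (w : Walk (Adj T) x y) → Climb ℓ x → Climb (walkLength w + ℓ) y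
    climb-along               []      c = c
    climb-along {y = y} {ℓ} (e ∷ w) c = subst (λ m → Climb m y) (+-suc (walkLength w) ℓ) (climb-along w (up (∼-sym e) c))

    walk-from-r : ∀ {x z ℓ} → Climb ℓ x → (w : Walk (Adj T) x z) →
                  Σ (Walk (Adj T) r z) λ w′ → walkLength w′ ≡ ℓ + walkLength w
    walk-from-r stop           w = w , refl
    walk-from-r {ℓ = suc ℓ} (up e c) w with walk-from-r c (∼-sym e ∷ w)
    ... | w′ , eq = w′ , trans eq (+-suc ℓ (walkLength w))

  leaf⇒dep : ∀ {x} → Leaf T x → dep x ≡ d
  leaf⇒dep {x} l with complete x l
  ... | (w , eq) , min = ≤-antisym
    (dep-min (subst (λ m → Climb m x) (trans (+-identityʳ _) eq) (climb-along w stop)))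
    (let w′ , eq′ = walk-from-r (dep-climb x) [] in
     subst (d ≤_) (trans eq′ (+-identityʳ _)) (min w′))

  -- Otherwise all leaves would have depth 0 and equal the root, while there are at least three.
  r-not-leaf : ¬ Leaf T r
  r-not-leaf l = <⇒≱ (≤-trans (s≤s (s≤s z≤n)) (proj₂ (proj₂ (proj₂ halin))))
    (unique⊆⇒length≤ {ys = r ∷ []} leaves-unique λ x∈ →
      here (dep-0 (trans (leaf⇒dep (leaf∈leaves x∈)) (trans (sym (leaf⇒dep l)) dep-r))))

  leaf≢r : ∀ {x} → Leaf T x → x ≢ r
  leaf≢r l refl = r-not-leaf l

  private
    deg≥1 : ∀ v → 1 ≤ deg T v
    deg≥1 v with v Fin.≟ r
    ... | no  v≢r = deg-positive (par-∼ v≢r)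
    ... | yes refl with leaves T | proj₂ (proj₂ (proj₂ halin)) | leaf∈leaves
    ...   | x ∷ _ | _ | leaf with proj₁ (proj₁ halin) r x
    ...     | []    = contradiction (leaf (here refl)) r-not-leaf
    ...     | e ∷ _ = deg-positive e

  deg≥3 : ∀ {v} → ¬ Leaf T v → 3 ≤ deg T v
  deg≥3 {v} ¬l with deg T v | deg≥1 v | proj₁ (proj₂ halin) v | ¬l
  ... | 1                 | _ | _   | p = contradiction refl p
  ... | 2                 | _ | ¬2  | _ = contradiction refl ¬2
  ... | suc (suc (suc _)) | _ | _   | _ = s≤s (s≤s (s≤s z≤n))

  rot≢ : ∀ {v u} → ¬ Leaf T v → Adj T v u → rot v u ≢ u
  rot≢ {v} ¬l e = Cyclic.no-fix v (nbrs-unique v) (<⇒≤ (deg≥3 ¬l)) (∈-nbrs⁺ e)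

  rot²≢ : ∀ {v u} → ¬ Leaf T v → Adj T v u → rot v (rot v u) ≢ u
  rot²≢ {v} ¬l e = Cyclic.no-2-cycle v (nbrs-unique v) (deg≥3 ¬l) (∈-nbrs⁺ e)

  rot-leaf : ∀ {x y} → Leaf T x → Adj T x y → rot x y ≡ y
  rot-leaf l e = leaf-nbr-unique l (rot-∼ e) e

  -- The child that follows the parent edge in the rotation. At the root, which has no parent edge,
  -- the value carries no meaning.
  first : Fin N → Fin N
  first v = rot v (par v)

  first-child : ∀ {v} → ¬ Leaf T v → v ≢ r → first v ≢ r × par (first v) ≡ v
  first-child ¬l v≢r = child (rot-∼ (par-∼ v≢r)) (rot≢ ¬l (par-∼ v≢r))

  private
    some-child : ∀ {v} → ¬ Leaf T v → ∃[ z ] z ≢ r × par z ≡ v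
    some-child {v} ¬l with v Fin.≟ r
    ... | no  v≢r  = _ , first-child ¬l v≢r
    ... | yes refl with nbrs r | deg≥1 r | ∈-nbrs⁻ {r}
    ...   | z ∷ _ | _ | nbr = z , child (nbr (here refl)) (nbr-of-r (nbr (here refl)))

    maxDep : ℕ
    maxDep = maxList (map dep (allFin N))

    dep≤max : ∀ x → dep x ≤ maxDep
    dep≤max x = maxList-≥ _ (∈-map⁺ dep (∈-allFin x))

    -- Passing to a child increases the depth, which `maxDep` bounds, so repeated descent stops at a
    -- leaf; `m` measures what remains.
    leaf-below : ∀ m v → maxDep ∸ dep v ≡ m → ∃[ x ] Leaf T x × dep v ≤ dep x
    leaf-below m v eq with leaf? v
    ... | yes l = v , l , ≤-refl
    ... | no ¬l with some-child ¬l
    ...   | z , z≢r , refl with m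
    ...     | zero  = contradiction (<-≤-trans (dep-child z≢r) (dep≤max z)) (≤⇒≯ (m∸n≡0⇒m≤n eq))
    ...     | suc m with leaf-below m z (suc-injective (trans (sym shift) eq))
      where
      shift : maxDep ∸ dep v ≡ suc (maxDep ∸ dep z)
      shift rewrite dep-par z≢r = +-∸-assoc 1 {maxDep} {suc (dep (par z))} (subst (_≤ maxDep) (dep-par z≢r) (dep≤max z))
    ...       | x , l , le = x , l , ≤-trans (<⇒≤ (dep-child z≢r)) le

  dep≤d : ∀ v → dep v ≤ d
  dep≤d v with leaf-below _ v refl
  ... | x , l , le = subst (dep v ≤_) (leaf⇒dep l) le

  parent-not-leaf : ∀ {x} → x ≢ r → ¬ Leaf T (par x)
  parent-not-leaf {x} x≢r l = <-irrefl (leaf⇒dep l) (<-≤-trans (dep-child x≢r) (dep≤d x))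

  -- An inner vertex at depth `d` would have a child deeper than `dep≤d` allows. This is how
  -- completeness makes all siblings of a leaf leaves.
  dep⇒leaf : ∀ {x} → dep x ≡ d → Leaf T x
  dep⇒leaf {x} e with leaf? x
  ... | yes l = l
  ... | no ¬l with some-child ¬l
  ...   | z , z≢r , refl = contradiction (dep≤d z) (<⇒≱ (subst (_< dep z) e (dep-child z≢r)))

  sibling-leaf : ∀ {x y} → Leaf T x → y ≢ r → par y ≡ par x → Leaf T y
  sibling-leaf l y≢r e = dep⇒leaf (trans (dep-par y≢r) (trans (cong (suc ∘ dep) e) (trans (sym (dep-par (leaf≢r l))) (leaf⇒dep l))))

  not-leaf⇒dep< : ∀ {x} → ¬ Leaf T x → dep x < d
  not-leaf⇒dep< ¬l = ≤∧≢⇒< (dep≤d _) (¬l ∘ dep⇒leaf)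

  -- The facial walk and the successor of a leaf.

  Dart : Set
  Dart = Fin N × Fin N

  step : Dart → Dart
  step = faceStep rot

  -- Counting starts at `k = 0`, unlike in `NextLeaf`: a dart that ends in a leaf has that leaf as
  -- its first one.
  FirstLeaf : Dart → Fin N → Set
  FirstLeaf e y = ∃[ k ] proj₂ (iter k step e) ≡ y × Leaf T y × (∀ j → j < k → ¬ Leaf T (proj₂ (iter j step e)))

  first-leaf-step : ∀ {e y} → ¬ Leaf T (proj₂ e) → FirstLeaf (step e) y → FirstLeaf e y
  first-leaf-step {e} ¬l (k , eq , l , none) = suc k , trans (cong proj₂ (sym (iter-suc k step e))) eq , l , none′
    where
    none′ : ∀ j → j < suc k → ¬ Leaf T (proj₂ (iter j step e))
    none′ zero    _         = ¬l
    none′ (suc j) (s≤s j<k) = subst (λ z → ¬ Leaf T (proj₂ z)) (iter-suc j step e) (none j j<k)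

  -- Meant for leaves y, whose depth is d.
  _isBelow_ : Fin N → Fin N → Set
  y isBelow a = iter (d ∸ dep a) par y ≡ a

  private
    gap : ∀ {z} → z ≢ r → d ∸ dep (par z) ≡ suc (d ∸ dep z)
    gap {z} z≢r rewrite dep-par z≢r = +-∸-assoc 1 {d} {suc (dep (par z))} (subst (_≤ d) (dep-par z≢r) (dep≤d z))

    below-par : ∀ {y z} → z ≢ r → y isBelow z → y isBelow par z
    below-par {y} {z} z≢r b = trans (cong (λ m → iter m par y) (gap z≢r)) (cong par b)

    -- Entering `a` from its parent, the walk turns to `first a`, again downwards, and so reaches a
    -- leaf inside the subtree of `a`.
    descend : ∀ m a → a ≢ r → d ∸ dep a ≡ m → ∃[ y ] FirstLeaf (par a , a) y × y isBelow a
    descend m a a≢r eq with leaf? a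
    ... | yes l = a , (0 , refl , l , λ _ ()) , cong (λ m → iter m par a) (trans (cong (d ∸_) (leaf⇒dep l)) (n∸n≡0 d))
    ... | no ¬l with first-child ¬l a≢r
    ...   | z≢r , pz with m
    ...     | zero  = contradiction (m∸n≡0⇒m≤n eq) (<⇒≱ (not-leaf⇒dep< ¬l))
    ...     | suc m with descend m _ z≢r (suc-injective (trans (sym (gap z≢r)) (trans (cong (λ z → d ∸ dep z) pz) eq)))
    ...       | y , fl , b = y , first-leaf-step ¬l (subst (λ z → FirstLeaf (z , first a) y) pz fl) ,
                             subst (y isBelow_) pz (below-par z≢r b)

    -- At `par a` the walk either goes on upwards, and then ends at a leaf not even below `par a`,
    -- or turns down into a sibling of `a`.
    ascend : ∀ m a → a ≢ r → dep a ≡ m → ∃[ y ] FirstLeaf (a , par a) y × ¬ (y isBelow a)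
    ascend zero    a a≢r eq = contradiction (dep-0 eq) a≢r
    ascend (suc m) a a≢r eq with par-or-child (rot-∼ (par-∼′ a≢r))
    ... | inj₁ (b≢r , pb) with ascend m _ b≢r (suc-injective (trans (sym (dep-par a≢r)) eq))
    ...   | y , fl , ¬b = y , first-leaf-step (parent-not-leaf a≢r) (subst (λ z → FirstLeaf (par a , z) y) pb fl) ,
                          ¬b ∘ below-par a≢r
    ascend (suc m) a a≢r eq | inj₂ (z≢r , pz) with descend _ _ z≢r refl
    ...   | y , fl , b = y , first-leaf-step (parent-not-leaf a≢r) (subst (λ w → FirstLeaf (w , rot (par a) a) y) pz fl) ,
      -- Siblings have equal depth, so a leaf below both would force them to be equal.
      λ b′ → rot≢ (parent-not-leaf a≢r) (par-∼′ a≢r)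
        (trans (sym b) (trans (cong (λ m → iter m par y)
          (suc-injective (trans (sym (gap z≢r)) (trans (cong (λ w → d ∸ dep w) pz) (gap a≢r))))) b′))

    NextLeaf′ = NextLeaf T rot

    -- The walk turns back at a leaf: the dart into `x` is followed by the dart to `par x`, which
    -- accounts for `suc k`.
    from-first-leaf : ∀ {x y} → Leaf T x → FirstLeaf (x , par x) y → NextLeaf′ x y
    from-first-leaf {x} {y} l (k , eq , l′ , none) = l , l′ , par x , par-∼′ (leaf≢r l) , suc k , s≤s z≤n ,
      trans (cong proj₂ (sym (shift k))) eq , none′
      where
      shift : ∀ k → iter k step (x , par x) ≡ iter (suc k) step (par x , x)
      shift k = trans (cong (λ w → iter k step (x , w)) (sym (rot-leaf l (par-∼ (leaf≢r l))))) (iter-suc k step _)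
      none′ : ∀ j → 1 ≤ j → j < suc k → ¬ Leaf T (proj₂ (iter j step (par x , x)))
      none′ (suc j) _ (s≤s j<k) = subst (λ z → ¬ Leaf T (proj₂ z)) (shift j) (none j j<k)

    next-exists : ∀ {x} → Leaf T x → ∃[ y ] NextLeaf′ x y
    next-exists l with ascend _ _ (leaf≢r l) refl
    ... | y , fl , _ = y , from-first-leaf l fl

  NextLeaf-functional : ∀ {x y y′} → NextLeaf T rot x y → NextLeaf T rot x y′ → y ≡ y′
  NextLeaf-functional (l , ly , p , e , k , 1≤k , eq , none) (_ , ly′ , p′ , e′ , k′ , 1≤k′ , eq′ , none′)
    with refl ← leaf-nbr-unique l (∼-sym e) (∼-sym e′) with <-cmp k k′
  ... | tri< k<k′ _ _ = contradiction (subst (Leaf T) (sym eq) ly) (none′ k 1≤k k<k′)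
  ... | tri≈ _ refl _ = trans (sym eq) eq′
  ... | tri> _ _ k′<k = contradiction (subst (Leaf T) (sym eq′) ly′) (none k′ 1≤k′ k′<k)

  private
    IsDart : Dart → Set
    IsDart (x , y) = Adj T x y

    step-dart : ∀ k {e} → IsDart e → IsDart (iter k step e)
    step-dart zero    a = a
    step-dart (suc k) a = rot-∼ (∼-sym (step-dart k a))

    step-injective : ∀ {e e′} → IsDart e → IsDart e′ → step e ≡ step e′ → e ≡ e′
    step-injective {x , y} {x′ , y′} a a′ eq with cong proj₁ eq
    ... | refl = cong (_, y) (rot-injective (∼-sym a) (∼-sym a′) (cong proj₂ eq))

    cancel : ∀ k {e e′} → IsDart e → IsDart e′ → iter k step e ≡ iter k step e′ → e ≡ e′
    cancel zero    _ _  eq = eq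
    cancel (suc k) a a′ eq = cancel k a a′ (step-injective (step-dart k a) (step-dart k a′) eq)

    -- Both walks arrive at the leaf `y` by its only edge, and steps on darts can be cancelled.
    -- Hence the dart starting the shorter walk occurs on the longer one; unless it is the start of
    -- that one too, the leaf `x` would interrupt it.
    inj≤ : ∀ {x x′ y} → ((lx , _ , _ , _ , k , _) : NextLeaf′ x y) ((_ , _ , _ , _ , k′ , _) : NextLeaf′ x′ y) →
           k ≤ k′ → x ≡ x′
    inj≤ {x} {x′} {y} (lx , ly , p , e , k , 1≤k , eq , none) (_ , _ , p′ , e′ , k′ , 1≤k′ , eq′ , none′) k≤k′
      = go (k′ ∸ k) refl
      where
      same : iter k step (p , x) ≡ iter k′ step (p′ , x′)
      same = cong₂ _,_ (leaf-nbr-unique ly (∼-sym (subst (Adj T _) eq (step-dart k e)))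
                                           (∼-sym (subst (Adj T _) eq′ (step-dart k′ e′)))) (trans eq (sym eq′))
      back : (p , x) ≡ iter (k′ ∸ k) step (p′ , x′)
      back = cancel k e (step-dart (k′ ∸ k) e′) (trans same (trans (cong (λ m → iter m step (p′ , x′)) (sym (m+[n∸m]≡n k≤k′))) (iter-+ k (k′ ∸ k) step _)))
      go : ∀ m → k′ ∸ k ≡ m → x ≡ x′
      go zero    q = cong proj₂ (trans back (cong (λ m → iter m step (p′ , x′)) q))
      go (suc m) q = contradiction (subst (Leaf T ∘ proj₂) back lx)
        (none′ (k′ ∸ k) (subst (1 ≤_) (sym q) (s≤s z≤n)) (m>n⇒m∸n<m 1≤k k≤k′))
        where
        m>n⇒m∸n<m : ∀ {a b} → 1 ≤ a → a ≤ b → b ∸ a < b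
        m>n⇒m∸n<m {suc a} {suc b} _ _ = s≤s (m∸n≤m b a)

  NextLeaf-injective : ∀ {x x′ y} → NextLeaf T rot x y → NextLeaf T rot x′ y → x ≡ x′
  NextLeaf-injective nl nl′ with ≤-total (proj₁ (proj₂ (proj₂ (proj₂ (proj₂ nl))))) (proj₁ (proj₂ (proj₂ (proj₂ (proj₂ nl′)))))
  ... | inj₁ le = inj≤ nl nl′ le
  ... | inj₂ le = sym (inj≤ nl′ nl le)

  abstract
    next : Fin N → Fin N
    next x with leaf? x
    ... | yes l = proj₁ (next-exists l)
    ... | no  _ = x

    next-NextLeaf : ∀ {x} → Leaf T x → NextLeaf T rot x (next x)
    next-NextLeaf {x} l with leaf? x
    ... | yes l′ = proj₂ (next-exists l′)
    ... | no  ¬l = contradiction l ¬l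

  NextLeaf⇒next : ∀ {x y} → NextLeaf T rot x y → next x ≡ y
  NextLeaf⇒next nl = NextLeaf-functional (next-NextLeaf (proj₁ nl)) nl

  next-leaf : ∀ {x} → Leaf T x → Leaf T (next x)
  next-leaf l = proj₁ (proj₂ (next-NextLeaf l))

  next-injective : ∀ {x y} → Leaf T x → Leaf T y → next x ≡ next y → x ≡ y
  next-injective {x} l l′ eq = NextLeaf-injective (subst (NextLeaf T rot x) eq (next-NextLeaf l)) (next-NextLeaf l′)

  abstract
    prev : Fin N → Fin N
    prev y with leaf? y
    ... | yes l = proj₁ (Permutation.preimage (Leaf T) next next-leaf next-injective l)
    ... | no  _ = y

    prev-leaf : ∀ {y} → Leaf T y → Leaf T (prev y)
    prev-leaf {y} l with leaf? y
    ... | yes l′ = proj₁ (proj₂ (Permutation.preimage (Leaf T) next next-leaf next-injective l′))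
    ... | no  ¬l = contradiction l ¬l

    next-prev : ∀ {y} → Leaf T y → next (prev y) ≡ y
    next-prev {y} l with leaf? y
    ... | yes l′ = proj₂ (proj₂ (Permutation.preimage (Leaf T) next next-leaf next-injective l′))
    ... | no  ¬l = contradiction l ¬l

  prev-next : ∀ {x} → Leaf T x → prev (next x) ≡ x
  prev-next l = next-injective (prev-leaf (next-leaf l)) l (next-prev (next-leaf l))

  -- Sibling groups and crossing edges.

  Cross : Fin N → Set
  Cross u = par (next u) ≢ par u

  cross? : ∀ u → Dec (Cross u)
  cross? u = ¬? (par (next u) Fin.≟ par u)

  inner : ∀ {u} → ¬ Cross u → par (next u) ≡ par u
  inner {u} ¬c with par (next u) Fin.≟ par u
  ... | yes p = p
  ... | no  p = contradiction p ¬c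

  private
    -- A turn at `par u` to anything but the grandparent arrives at a sibling of `u`, which is a
    -- leaf and ends the search at once.
    next-in-group : ∀ {u} → Leaf T u → rot (par u) u ≢ par (par u) →
                    next u ≡ rot (par u) u × par (rot (par u) u) ≡ par u
    next-in-group {u} l p with child (rot-∼ (par-∼′ (leaf≢r l))) p
    ... | z≢r , pz = NextLeaf⇒next (from-first-leaf l
          (first-leaf-step (parent-not-leaf (leaf≢r l)) (0 , refl , sibling-leaf l z≢r pz , λ _ ()))) , pz

    -- The walk goes up from `par u`, and `ascend` ends it at a leaf outside the subtree of `par u`.
    next-out-of-group : ∀ {u} → Leaf T u → rot (par u) u ≡ par (par u) → par u ≢ r × Cross u
    next-out-of-group {u} l p = v≢r , cr
      where
      v≢r : par u ≢ r
      v≢r q = nbr-of-r (subst (λ z → Adj T z (rot (par u) u)) q (rot-∼ (par-∼′ (leaf≢r l)))) (trans p (cong par q))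
      cr : Cross u
      cr e with ascend _ _ v≢r refl
      ... | y , fl , ¬b with NextLeaf⇒next (from-first-leaf l (first-leaf-step (parent-not-leaf (leaf≢r l)) (subst (λ z → FirstLeaf (par u , z) y) (sym p) fl)))
      -- The depths of `u` and `par u` are `d` and one less, so `isBelow` here means a single
      -- application of `par`.
      ...   | refl = ¬b (trans (cong (λ m → iter m par y) (trans (gap (leaf≢r l)) (cong suc (trans (cong (d ∸_) (leaf⇒dep l)) (n∸n≡0 d))))) e)

  inner-rot : ∀ {u} → Leaf T u → ¬ Cross u → next u ≡ rot (par u) u
  inner-rot {u} l ¬c with rot (par u) u Fin.≟ par (par u)
  ... | yes p = contradiction (proj₂ (next-out-of-group l p)) ¬c
  ... | no  p = proj₁ (next-in-group l p)

  cross-rot : ∀ {u} → Leaf T u → Cross u → rot (par u) u ≡ par (par u)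
  cross-rot {u} l c with rot (par u) u Fin.≟ par (par u)
  ... | yes p = p
  ... | no  p with next-in-group l p
  ...   | q , q′ = contradiction (trans (cong par q) q′) c

  cross≢r : ∀ {u} → Leaf T u → Cross u → par u ≢ r
  cross≢r l c = proj₁ (next-out-of-group l (cross-rot l c))

  abstract
    -- The predecessor of the parent in the rotation, found by search. The root has none and gets
    -- itself.
    final : Fin N → Fin N
    final v with Fin.any? (λ a → ∼-dec v a ×-dec (rot v a Fin.≟ par v))
    ... | yes (a , _) = a
    ... | no  _       = v

    final-cross : ∀ {u} → Leaf T u → Cross u → final (par u) ≡ u
    final-cross {u} l c with Fin.any? (λ a → ∼-dec (par u) a ×-dec (rot (par u) a Fin.≟ par (par u)))
    ... | yes (a , e , p) = rot-injective e (par-∼′ (leaf≢r l)) (trans p (sym (cross-rot l c)))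
    ... | no  none        = contradiction (u , par-∼′ (leaf≢r l) , cross-rot l c) none

  -- If the rotational predecessor `a` of `next u` were not the parent, it would be a sibling leaf
  -- with `next a ≡ next u`; then `a` is `u`, which has a different parent.
  first-cross : ∀ {u} → Leaf T u → Cross u → first (par (next u)) ≡ next u
  first-cross {u} l c with rot-surjective (par-∼′ (leaf≢r (next-leaf l)))
  ... | a , e , p with a Fin.≟ par (par (next u))
  ...   | yes refl = p
  ...   | no  q with child e q
  ...     | a≢r , pa = contradiction (trans (sym pa) (cong par (next-injective la l eq))) c
    where
    la : Leaf T a
    la = sibling-leaf (next-leaf l) a≢r pa
    p′ : rot (par a) a ≡ next u
    p′ = trans (cong (λ z → rot z a) pa) p
    up-≢ : rot (par a) a ≢ par (par a)
    up-≢ e′ = par-≢ (trans (sym p′) (trans e′ (cong par pa)))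
      where
      par-≢ : next u ≢ par (par (next u))
      par-≢ x with par (next u) Fin.≟ r
      ... | yes y = nbr-of-r (subst (λ z → Adj T z (next u)) y (par-∼′ (leaf≢r (next-leaf l)))) (trans x (cong par y))
      ... | no  y = par-antisym (leaf≢r (next-leaf l)) y refl (sym x)
    eq : next a ≡ next u
    eq = trans (proj₁ (next-in-group la up-≢)) p′

  -- Otherwise `next u` would be both first and final child, and the rotation at its parent would
  -- close after two steps, against degree at least 3.
  cross-next-inner : ∀ {u} → Leaf T u → Cross u → ¬ Cross (next u)
  cross-next-inner {u} l c c′ = rot²≢ (parent-not-leaf (leaf≢r ln)) (par-∼ (cross≢r ln c′))
    (trans (cong (rot (par (next u))) (first-cross l c)) (cross-rot ln c′))
    where
    ln = next-leaf l

  next≢ : ∀ {u} → Leaf T u → next u ≢ u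
  next≢ {u} l e with cross? u
  ... | yes c = c (cong par e)
  ... | no ¬c = rot≢ (parent-not-leaf (leaf≢r l)) (par-∼′ (leaf≢r l)) (trans (sym (inner-rot l ¬c)) e)

  -- With exactly one crossing among the two edges, the parent changes once and cannot return; with
  -- none, the rotation would have a 2-cycle.
  next²≢ : ∀ {u} → Leaf T u → next (next u) ≢ u
  next²≢ {u} l e with cross? u | cross? (next u)
  ... | yes c | yes c′ = cross-next-inner l c c′
  ... | yes c | no ¬c′ = c (trans (sym (inner ¬c′)) (cong par e))
  ... | no ¬c | yes c′ = c′ (trans (cong par e) (sym (inner ¬c)))
  ... | no ¬c | no ¬c′ = rot²≢ (parent-not-leaf (leaf≢r l)) (par-∼′ (leaf≢r l))
    (trans (cong (rot (par u)) (sym (inner-rot l ¬c)))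
      (trans (cong (λ z → rot z (next u)) (sym (inner ¬c))) (trans (sym (inner-rot (next-leaf l) ¬c′)) e)))

  leaf-inner : ∀ {x y} → Leaf T x → Adj T x y → y ≡ par x
  leaf-inner l e = leaf-nbr-unique l e (par-∼ (leaf≢r l))

-- Greedy list colouring.

module Greedy {Item : Set} (rank : Item → ℕ) (palette : Item → List ℕ) (conflicts : Item → List Item) where

  earlier : Item → List Item
  earlier i = filter (λ j → rank j <? rank i) (conflicts i)

  private
    -- `m` is fuel. Earlier conflicts have smaller rank, so the value no longer changes once `m`
    -- exceeds the rank.
    approx : ℕ → Item → ℕ
    approx zero    i = 0
    approx (suc m) i = pick (palette i) (map (approx m) (earlier i))

    approx-stable : ∀ m {i} → rank i < m → approx m i ≡ approx (suc m) i
    approx-stable (suc m) {i} (s≤s le) = cong (pick (palette i)) (List.map-cong-local (All.tabulate λ j∈ →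
      approx-stable m (<-≤-trans (proj₂ (∈-filter⁻ (λ j → rank j <? rank i) {xs = conflicts i} j∈)) le)))

    approx-eventually : ∀ k {i} → approx (k + suc (rank i)) i ≡ approx (suc (rank i)) i
    approx-eventually zero        = refl
    approx-eventually (suc k) {i} =
      trans (sym (approx-stable (k + suc (rank i)) (m≤n+m _ k))) (approx-eventually k)

  Free : Item → Set
  Free i = Unique (palette i) × length (earlier i) < length (palette i)

  abstract
    colour : Item → ℕ
    colour i = approx (suc (rank i)) i

    private
      spec : ∀ {i} → Free i → colour i ∈ palette i × colour i ∉ map (approx (rank i)) (earlier i)
      spec {i} (u , lt) = pick-spec u (subst (_< length (palette i)) (sym (List.length-map _ (earlier i))) lt)

    colour-∈ : ∀ {i} → Free i → colour i ∈ palette i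
    colour-∈ free = proj₁ (spec free)

    colour-≢ : ∀ {i j} → Free i → j ∈ conflicts i → rank j < rank i → colour i ≢ colour j
    colour-≢ {i} {j} free j∈ lt eq = proj₂ (spec free) (subst (_∈ map (approx (rank i)) (earlier i)) same
      (∈-map⁺ (approx (rank i)) (∈-filter⁺ (λ j → rank j <? rank i) j∈ lt)))
      where
      -- The forbidden colours were computed with fuel `rank i`, which exceeds `rank j` and hence
      -- gives the final colour of `j`.
      same : approx (rank i) j ≡ colour i
      same = trans (cong (λ m → approx m j) (sym (m∸n+n≡m lt))) (trans (approx-eventually (rank i ∸ suc (rank j))) (sym eq))

-- toPar v is the edge from v to its parent, toNext u the edge of the adjoint
-- cycle from the leaf u to the next leaf.
data Item (N : ℕ) : Set where
  toPar toNext : Fin N → Item N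

-- Numerical bounds.

module Bounds {N : ℕ} (T : BGraph N) where
  open Neighbours T

  private
    K = halinBound T

  -- Doubling gives `deg T x + (deg T x + deg T y)`, at most `Δ T + θ T`.
  deg+half≤K : ∀ {x y} → Adj T x y → deg T x + deg T y / 2 ≤ K
  deg+half≤K {x} {y} e = ≤-trans (begin
    deg T x + deg T y / 2            ≡⟨ cong (_+ deg T y / 2) (m*n/n≡m (deg T x) 2) ⟨
    deg T x * 2 / 2 + deg T y / 2    ≡⟨ +-distrib-/-∣ˡ {deg T x * 2} (deg T y) {2} (divides-refl (deg T x)) ⟨
    (deg T x * 2 + deg T y) / 2      ≤⟨ /-monoˡ-≤ 2 sum≤ ⟩
    (θ T + Δ T) / 2                  ∎) (m≤m⊔n _ (2 * (Δ T / 2) + 6))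
    where
    open ≤-Reasoning
    sum≤ : deg T x * 2 + deg T y ≤ θ T + Δ T
    sum≤ = begin
      deg T x * 2 + deg T y            ≡⟨ cong (_+ deg T y) (trans (*-comm (deg T x) 2) (cong (deg T x +_) (+-identityʳ _))) ⟩
      deg T x + deg T x + deg T y      ≡⟨ +-assoc (deg T x) (deg T x) (deg T y) ⟩
      deg T x + (deg T x + deg T y)    ≡⟨ +-comm (deg T x) _ ⟩
      deg T x + deg T y + deg T x      ≤⟨ +-mono-≤ (deg+deg≤θ e) (deg≤Δ x) ⟩
      θ T + Δ T                        ∎

  even-bound : 2 * (Δ T / 2) + 6 ≤ K
  even-bound = m≤n⊔m ((θ T + Δ T) / 2) _

  6≤K : 6 ≤ K
  6≤K = ≤-trans (m≤n+m 6 (2 * (Δ T / 2))) even-bound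

  deg+5≤K : ∀ x → deg T x + 5 ≤ K
  deg+5≤K x = ≤-trans (begin
    deg T x + 5                      ≤⟨ +-monoˡ-≤ 5 (deg≤Δ x) ⟩
    Δ T + 5                          ≡⟨ cong (_+ 5) (m≡m%n+[m/n]*n (Δ T) 2) ⟩
    Δ T % 2 + Δ T / 2 * 2 + 5        ≤⟨ +-monoˡ-≤ 5 (+-mono-≤ (≤-pred (m%n<n (Δ T) 2)) (≤-reflexive (*-comm (Δ T / 2) 2))) ⟩
    1 + 2 * (Δ T / 2) + 5            ≡⟨ +-suc (2 * (Δ T / 2)) 5 ⟨
    2 * (Δ T / 2) + 6                ∎) even-bound
    where open ≤-Reasoning

  -- Degree 3 forces `Δ T / 2` to be at least 1, so the second copy of this half pays for
  -- strictness.
  6+half<K : ∀ {x h} → 3 ≤ deg T x → h ≤ Δ T / 2 → 6 + h < K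
  6+half<K {x} {h} three le = ≤-trans (begin
    7 + h                            ≡⟨ +-comm 7 h ⟩
    h + 7                            ≤⟨ +-monoˡ-≤ 7 le ⟩
    Δ T / 2 + 7                      ≡⟨ +-suc (Δ T / 2) 6 ⟩
    1 + (Δ T / 2) + 6                ≤⟨ +-monoˡ-≤ 6 (+-monoˡ-≤ (Δ T / 2) (/-monoˡ-≤ {m = 2} 2 (≤-trans (<⇒≤ three) (deg≤Δ x)))) ⟩
    Δ T / 2 + Δ T / 2 + 6            ≡⟨ cong (λ m → Δ T / 2 + m + 6) (+-identityʳ _) ⟨
    2 * (Δ T / 2) + 6                ∎) even-bound
    where open ≤-Reasoning

-- Conflict lists and the order of colouring.

module Colouring {N : ℕ} (T : BGraph N) (rot : Fin N → Fin N → Fin N) (halin : IsHalinData T rot)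
                 (r : Fin N) (d : ℕ) (complete : ∀ x → Leaf T x → Dist (Adj T) r x d)
                 (L : Fin N → Fin N → List ℕ)
                 (lists : ListAssignment (HalinAdj T rot) (halinBound T) L) where
  open Halin T rot halin r d complete public
  open Bounds T

  private
    K = halinBound T

  -- Names a tree edge by its lower end, from whichever end it is seen; meaningful only for adjacent
  -- `m` and `z`.
  edge : Fin N → Fin N → Item N
  edge m z with z Fin.≟ par m
  ... | yes _ = toPar m
  ... | no  _ = toPar z

  edge-par : ∀ {m z} → z ≡ par m → edge m z ≡ toPar m
  edge-par {m} {z} e with z Fin.≟ par m
  ... | yes _ = refl
  ... | no  p = contradiction e p

  edge-child : ∀ {m z} → z ≢ par m → edge m z ≡ toPar z
  edge-child {m} {z} e with z Fin.≟ par m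
  ... | yes p = contradiction p e
  ... | no  _ = refl

  par≢ : ∀ {v} → v ≢ r → v ≢ par (par v)
  par≢ {v} v≢r e with par v Fin.≟ r
  ... | yes q = v≢r (trans e (trans (cong par q) par-r))
  ... | no  q = par-antisym v≢r q refl (sym e)

  edge-up : ∀ {v} → v ≢ r → edge (par v) v ≡ toPar v
  edge-up v≢r = edge-child (par≢ v≢r)

  edge-sym : ∀ {m z} → Adj T m z → edge m z ≡ edge z m
  edge-sym e with par-or-child e
  ... | inj₁ (m≢r , refl) = trans (edge-par refl) (sym (edge-up m≢r))
  ... | inj₂ (z≢r , refl) = trans (edge-up z≢r) (sym (edge-par refl))

  edgesAt : Fin N → List (Item N)
  edgesAt m = map (edge m) (nbrs m)

  otherEdges : Fin N → Fin N → List (Item N)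
  otherEdges m v = map (edge m) (filter (λ z → ¬? (z Fin.≟ v)) (nbrs m))

  halfAt : Fin N → Fin N → List (Item N)
  halfAt m x = map (edge m) (ahead m x)

  -- The edges from `par m` to the neighbours in the charge of `m`, to be avoided by the child edges
  -- of `m`.
  halfAbove : Fin N → List (Item N)
  halfAbove m with m Fin.≟ r
  ... | yes _ = []
  ... | no  _ = halfAt (par m) m

  ∈-edgesAt : ∀ {m z} → Adj T m z → edge m z ∈ edgesAt m
  ∈-edgesAt {m} e = ∈-map⁺ (edge m) (∈-nbrs⁺ e)

  ∈-otherEdges : ∀ {m v z} → Adj T m z → z ≢ v → edge m z ∈ otherEdges m v
  ∈-otherEdges {m} {v} e z≢v = ∈-map⁺ (edge m) (∈-filter⁺ (λ z → ¬? (z Fin.≟ v)) (∈-nbrs⁺ e) z≢v)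

  ∈-halfAbove : ∀ {x z} → x ≢ r → z ∈ ahead (par x) x → edge (par x) z ∈ halfAbove x
  ∈-halfAbove {x} x≢r z∈ with x Fin.≟ r
  ... | yes p = contradiction p x≢r
  ... | no  _ = ∈-map⁺ (edge (par x)) z∈

  length-edgesAt : ∀ m → length (edgesAt m) ≡ deg T m
  length-edgesAt m = List.length-map (edge m) (nbrs m)

  length-otherEdges : ∀ {m v} → Adj T m v → length (otherEdges m v) < deg T m
  length-otherEdges {m} {v} e = subst (_< deg T m) (sym (List.length-map (edge m) (filter (λ z → ¬? (z Fin.≟ v)) (nbrs m))))
    (List.filter-notAll (λ z → ¬? (z Fin.≟ v)) (nbrs m) (Any.map (λ { refl ¬e → ¬e refl }) (∈-nbrs⁺ e)))

  length-halfAt : ∀ m x → length (halfAt m x) ≡ deg T m / 2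
  length-halfAt m x = trans (List.length-map (edge m) (ahead m x)) (length-ahead m x)

  length-halfAbove : ∀ m → length (halfAbove m) ≤ Δ T / 2
  length-halfAbove m with m Fin.≟ r
  ... | yes _ = z≤n
  ... | no  _ = ≤-trans (≤-reflexive (length-halfAt (par m) m)) (/-monoˡ-≤ 2 (deg≤Δ (par m)))

  deg+halfAbove≤K : ∀ m → deg T m + length (halfAbove m) ≤ K
  deg+halfAbove≤K m with m Fin.≟ r
  ... | yes _   = ≤-trans (+-monoʳ-≤ (deg T m) z≤n) (deg+5≤K m)
  ... | no  m≢r = subst (λ l → deg T m + l ≤ K) (sym (length-halfAt (par m) m)) (deg+half≤K (par-∼ m≢r))

  -- Of the two ways to break a bichromatic path with middle vertex m = par v
  -- that passes through v and par m, the early children v take the one in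
  -- which toPar v differs from all colours at par m.
  Early : Fin N → Set
  Early v = par v ≢ r × v ∈ ahead (par v) (par (par v))

  early? : ∀ v → Dec (Early v)
  early? v = ¬? (par v Fin.≟ r) ×-dec Any.any? (v Fin.≟_) (ahead (par v) (par (par v)))

  -- The leaf children of v form a path of the adjoint cycle, from first v to
  -- final v; only the cycle edges entering first v and leaving final v cross to
  -- other parents.
  data Place : Set where
    atFirst atFinal atSecond atPenultimate elsewhere : Place

  -- Leaves near the ends must avoid the crossing edges, and can afford it while few siblings are
  -- coloured.
  order : Place → ℕ
  order atFirst       = 0
  order atFinal       = 1
  order atSecond      = 2
  order atPenultimate = 3
  order elsewhere     = 4

  data IsAt (u : Fin N) : Place → Set where
    isFirst       : u ≡ first (par u) → IsAt u atFirst
    isFinal       : u ≡ final (par u) → IsAt u atFinal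
    isSecond      : u ≡ next (first (par u)) → IsAt u atSecond
    isPenultimate : u ≡ prev (final (par u)) → IsAt u atPenultimate
    isElsewhere   : u ≢ first (par u) → u ≢ final (par u) → u ≢ next (first (par u)) →
                    u ≢ prev (final (par u)) → IsAt u elsewhere

  -- Places coincide in small groups; the first match counts.
  locate : ∀ u → ∃ (IsAt u)
  locate u with u Fin.≟ first (par u) | u Fin.≟ final (par u) | u Fin.≟ next (first (par u)) | u Fin.≟ prev (final (par u))
  ... | yes p | _     | _     | _     = _ , isFirst p
  ... | no  _ | yes p | _     | _     = _ , isFinal p
  ... | no  _ | no  _ | yes p | _     = _ , isSecond p
  ... | no  _ | no  _ | no  _ | yes p = _ , isPenultimate p
  ... | no  p | no  q | no  s | no  t = _ , isElsewhere p q s t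

  place : Fin N → Place
  place u = proj₁ (locate u)

  crossesOf : Fin N → List (Item N)
  crossesOf v = toNext (prev (first v)) ∷ toNext (final v) ∷ []

  -- Near the ends only siblings at places of smaller `order` need listing. The entries `prev u` and
  -- `next u` serve pairs of pendant edges joined by a crossing edge.
  pendantConflicts : Fin N → Place → List (Item N)
  pendantConflicts u elsewhere     = otherEdges (par u) u ++ halfAbove (par u)
  pendantConflicts u atFirst       = toPar (prev u) ∷ toPar (par u) ∷ crossesOf (par u) ++ halfAbove (par u)
  pendantConflicts u atFinal       = toPar (next u) ∷ toPar (first (par u)) ∷ toPar (par u) ∷ crossesOf (par u) ++ halfAbove (par u)
  pendantConflicts u atSecond      = toPar (first (par u)) ∷ toPar (final (par u)) ∷ toPar (par u) ∷ crossesOf (par u) ++ halfAbove (par u)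
  pendantConflicts u atPenultimate = toPar (first (par u)) ∷ toPar (final (par u)) ∷ toPar (next (first (par u))) ∷
                                     toPar (par u) ∷ crossesOf (par u) ++ halfAbove (par u)

  -- Beyond an inner cycle edge the danger is the next cycle edge; beyond a crossing edge it is the
  -- pendant edge, which is not at `par u`. One entry per side suffices.
  second-right second-left : Fin N → Item N
  second-right u with cross? (next u)
  ... | yes _ = toPar (next (next u))
  ... | no  _ = toNext (next (next u))
  second-left u with cross? (prev u)
  ... | yes _ = toPar (prev u)
  ... | no  _ = toNext (prev (prev u))

  -- Before an early edge only early siblings are coloured, so half of the edges at its parent
  -- suffice. A crossing edge lists the one entering the group of `u` and the one leaving the group
  -- of `next u`, which are two steps away when that group has two leaves.
  conflicts : Item N → List (Item N)
  conflicts (toPar v) with leaf? v | early? v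
  ... | yes _ | _     = pendantConflicts v (place v)
  ... | no  _ | yes _ = edgesAt (par (par v)) ++ halfAt (par v) (par (par v))
  ... | no  _ | no  _ = otherEdges (par v) v ++ halfAbove (par v)
  conflicts (toNext u) with cross? u
  ... | yes _ = toPar (par u) ∷ toPar (par (next u)) ∷ toNext (prev (first (par u))) ∷ toNext (final (par (next u))) ∷ []
  ... | no  _ = toNext (next u) ∷ second-right u ∷ toNext (prev u) ∷ second-left u ∷ edgesAt (par u)

  -- Each depth has two stages, early before late, so inner tree edges stay below `d + d`. Pendant
  -- edges take offsets 1 to 5, which leaves 6 for the non-crossing cycle edges.
  stage : Item N → ℕ
  stage (toPar v) with leaf? v | early? v
  ... | yes _ | _     = suc (order (place v)) + (d + d)
  ... | no  _ | yes _ = dep v + dep v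
  ... | no  _ | no  _ = suc (dep v + dep v)
  stage (toNext u) with cross? u
  ... | yes _ = d + d
  ... | no  _ = 6 + (d + d)

  conflicts-pendant : ∀ {v} → Leaf T v → conflicts (toPar v) ≡ pendantConflicts v (place v)
  conflicts-pendant {v} l with leaf? v
  ... | yes _ = refl
  ... | no ¬l = contradiction l ¬l

  conflicts-early : ∀ {v} → ¬ Leaf T v → Early v →
                    conflicts (toPar v) ≡ edgesAt (par (par v)) ++ halfAt (par v) (par (par v))
  conflicts-early {v} ¬l e with leaf? v | early? v
  ... | yes l | _     = contradiction l ¬l
  ... | no  _ | yes _ = refl
  ... | no  _ | no ¬e = contradiction e ¬e

  conflicts-late : ∀ {v} → ¬ Leaf T v → ¬ Early v → conflicts (toPar v) ≡ otherEdges (par v) v ++ halfAbove (par v)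
  conflicts-late {v} ¬l ¬e with leaf? v | early? v
  ... | yes l | _     = contradiction l ¬l
  ... | no  _ | yes e = contradiction e ¬e
  ... | no  _ | no  _ = refl

  conflicts-cross : ∀ {u} → Cross u → conflicts (toNext u) ≡
    toPar (par u) ∷ toPar (par (next u)) ∷ toNext (prev (first (par u))) ∷ toNext (final (par (next u))) ∷ []
  conflicts-cross {u} c with cross? u
  ... | yes _ = refl
  ... | no ¬c = contradiction c ¬c

  conflicts-inner : ∀ {u} → ¬ Cross u → conflicts (toNext u) ≡
    toNext (next u) ∷ second-right u ∷ toNext (prev u) ∷ second-left u ∷ edgesAt (par u)
  conflicts-inner {u} ¬c with cross? u
  ... | yes c = contradiction c ¬c
  ... | no  _ = refl

  stage-pendant : ∀ {v} → Leaf T v → stage (toPar v) ≡ suc (order (place v)) + (d + d)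
  stage-pendant {v} l with leaf? v
  ... | yes _ = refl
  ... | no ¬l = contradiction l ¬l

  stage-early : ∀ {v} → ¬ Leaf T v → Early v → stage (toPar v) ≡ dep v + dep v
  stage-early {v} ¬l e with leaf? v | early? v
  ... | yes l | _     = contradiction l ¬l
  ... | no  _ | yes _ = refl
  ... | no  _ | no ¬e = contradiction e ¬e

  stage-late : ∀ {v} → ¬ Leaf T v → ¬ Early v → stage (toPar v) ≡ suc (dep v + dep v)
  stage-late {v} ¬l ¬e with leaf? v | early? v
  ... | yes l | _     = contradiction l ¬l
  ... | no  _ | yes e = contradiction e ¬e
  ... | no  _ | no  _ = refl

  stage-cross : ∀ {u} → Cross u → stage (toNext u) ≡ d + d
  stage-cross {u} c with cross? u
  ... | yes _ = refl
  ... | no ¬c = contradiction c ¬c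

  stage-inner : ∀ {u} → ¬ Cross u → stage (toNext u) ≡ 6 + (d + d)
  stage-inner {u} ¬c with cross? u
  ... | yes c = contradiction c ¬c
  ... | no  _ = refl

  vertex : Item N → Fin N
  vertex (toPar v)  = v
  vertex (toNext u) = u

  -- Lexicographic: stage first, then the vertex, whose number is below `N`.
  rank : Item N → ℕ
  rank i = toℕ (vertex i) + stage i * N

  rank-stage : ∀ {i j} → stage i < stage j → rank i < rank j
  rank-stage {i} {j} lt = begin-strict
    toℕ (vertex i) + stage i * N   <⟨ +-monoˡ-< (stage i * N) (Fin.toℕ<n (vertex i)) ⟩
    N + stage i * N                ≤⟨ *-monoˡ-≤ N lt ⟩
    stage j * N                    ≤⟨ m≤n+m _ (toℕ (vertex j)) ⟩
    rank j                         ∎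
    where open ≤-Reasoning

  rank⇒stage : ∀ {i j} → rank i < rank j → stage i ≤ stage j
  rank⇒stage {i} {j} lt with stage i ≤? stage j
  ... | yes le = le
  ... | no ¬le = contradiction lt (<⇒≯ (rank-stage {j} {i} (≰⇒> ¬le)))

  rank-vertex : ∀ {i j} → rank i ≡ rank j → vertex i ≡ vertex j
  rank-vertex {i} {j} e with <-cmp (stage i) (stage j)
  ... | tri< lt _ _ = contradiction e (<⇒≢ (rank-stage {i} {j} lt))
  ... | tri> _ _ gt = contradiction (sym e) (<⇒≢ (rank-stage {j} {i} gt))
  ... | tri≈ _ s _  = Fin.toℕ-injective (+-cancelʳ-≡ (stage i * N) _ _ (trans e (cong (λ m → toℕ (vertex j) + m * N) (sym s))))

  -- Counting earlier conflicts.

  palette : Item N → List ℕ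
  palette (toPar v)  = L v (par v)
  palette (toNext u) = L u (next u)

  open Greedy rank palette conflicts public

  private
    palette-ok : ∀ {x y} → HalinAdj T rot x y → ∀ {m} → m < K → Unique (L x y) × m < length (L x y)
    palette-ok e lt = proj₁ (proj₂ lists _ _ e) , <-≤-trans lt (proj₂ (proj₂ lists _ _ e))

    earlier≤ : ∀ i → length (earlier i) ≤ length (conflicts i)
    earlier≤ i = List.length-filter (λ j → rank j <? rank i) (conflicts i)

    otherEdges-count : ∀ {v} → v ≢ r → length (otherEdges (par v) v ++ halfAbove (par v)) < K
    otherEdges-count {v} v≢r = subst (_< K) (sym (List.length-++ (otherEdges (par v) v)))
      (<-≤-trans (+-monoˡ-< (length (halfAbove (par v))) (length-otherEdges (par-∼′ v≢r))) (deg+halfAbove≤K (par v)))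

    -- The longest of the lists near the ends is the penultimate one: three siblings, the edge above
    -- and two crossing edges make 6.
    pendant-count : ∀ {v} → v ≢ r → ∀ p → length (pendantConflicts v p) < K
    pendant-count {v} v≢r = λ where
        atFirst       → ≤-<-trans (+-monoˡ-≤ h (m≤m+n 4 2)) six
        atFinal       → ≤-<-trans (+-monoˡ-≤ h (m≤m+n 5 1)) six
        atSecond      → ≤-<-trans (+-monoˡ-≤ h (m≤m+n 5 1)) six
        atPenultimate → six
        elsewhere     → otherEdges-count v≢r
      where
      h = length (halfAbove (par v))
      six : 6 + h < K
      six = 6+half<K (deg≥3 (parent-not-leaf v≢r)) (length-halfAbove (par v))

    -- The list itself may have `K` entries. Strictness comes from `toPar v`, which lies in its own
    -- half and is not earlier than itself.
    early-count : ∀ {v} → Early v → v ≢ r →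
                  length (filter (λ j → rank j <? rank (toPar v)) (edgesAt (par (par v)) ++ halfAt (par v) (par (par v)))) < K
    early-count {v} (m≢r , v∈) v≢r = begin-strict
      length (filter P? (edgesAt w ++ halfAt m w))                   ≡⟨ cong length (List.filter-++ P? (edgesAt w) (halfAt m w)) ⟩
      length (filter P? (edgesAt w) ++ filter P? (halfAt m w))       ≡⟨ List.length-++ (filter P? (edgesAt w)) ⟩
      length (filter P? (edgesAt w)) + length (filter P? (halfAt m w)) <⟨ +-mono-≤-< (≤-trans (List.length-filter P? (edgesAt w)) (≤-reflexive (length-edgesAt w)))
                                                                           (List.filter-notAll P? (halfAt m w) (Any.map (λ { refl → <-irrefl refl }) self)) ⟩
      deg T w + length (halfAt m w)                                  ≡⟨ cong (deg T w +_) (length-halfAt m w) ⟩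
      deg T w + deg T m / 2                                          ≤⟨ deg+half≤K (par-∼′ m≢r) ⟩
      K                                                              ∎
      where
      open ≤-Reasoning
      m = par v
      w = par m
      P? = λ j → rank j <? rank (toPar v)
      self : toPar v ∈ halfAt m w
      self = subst (_∈ halfAt m w) (edge-up v≢r) (∈-map⁺ (edge m) v∈)

    via : ∀ i {cs} → conflicts i ≡ cs → length cs < K → length (earlier i) < K
    via i eq lt = ≤-<-trans (earlier≤ i) (subst (λ cs → length cs < K) (sym eq) lt)

    toPar-count : ∀ {v} → v ≢ r → length (earlier (toPar v)) < K
    toPar-count {v} v≢r = go (leaf? v) (early? v)
      where
      go : Dec (Leaf T v) → Dec (Early v) → length (earlier (toPar v)) < K
      go (yes l) _       = via (toPar v) (conflicts-pendant l) (pendant-count v≢r (place v))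
      go (no ¬l) (yes e) = subst (λ cs → length (filter (λ j → rank j <? rank (toPar v)) cs) < K)
                                 (sym (conflicts-early ¬l e)) (early-count e v≢r)
      go (no ¬l) (no ¬e) = via (toPar v) (conflicts-late ¬l ¬e) (otherEdges-count v≢r)

    toNext-count : ∀ u → length (earlier (toNext u)) < K
    toNext-count u = go (cross? u)
      where
      go : Dec (Cross u) → length (earlier (toNext u)) < K
      go (yes c) = via (toNext u) (conflicts-cross c) (≤-trans (m≤m+n 5 1) 6≤K)
      go (no ¬c) = via (toNext u) (conflicts-inner ¬c)
        (subst (λ l → suc (4 + l) ≤ K) (sym (length-edgesAt (par u))) (subst (_≤ K) (+-comm (deg T (par u)) 5) (deg+5≤K (par u))))

  abstract
    toPar-free : ∀ {v} → v ≢ r → Free (toPar v)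
    toPar-free v≢r = palette-ok (inj₁ (par-∼ v≢r)) (toPar-count v≢r)

    toNext-free : ∀ {u} → Leaf T u → Free (toNext u)
    toNext-free {u} l = palette-ok (inj₂ (inj₁ (next-NextLeaf l))) (toNext-count u)

  -- Colours of tree edges.

  ∈-unfold : ∀ {i : Item N} {is js} → is ≡ js → i ∈ js → i ∈ is
  ∈-unfold refl = id

  -- For pairs of unknown relative order: whichever is coloured later lists the other.
  apart : ∀ {i j} → Free i → Free j → i ∈ conflicts j → j ∈ conflicts i → vertex i ≢ vertex j →
          colour i ≢ colour j
  apart {i} {j} fi fj i∈ j∈ ≢ with <-cmp (rank i) (rank j)
  ... | tri< lt _ _ = ≢-sym (colour-≢ fj i∈ lt)
  ... | tri≈ _ eq _ = contradiction (rank-vertex {i} {j} eq) ≢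
  ... | tri> _ _ gt = colour-≢ fi j∈ gt

  stage-≤ : ∀ {v} → ¬ Leaf T v → stage (toPar v) ≤ suc (dep v + dep v)
  stage-≤ {v} ¬l = go (early? v)
    where
    go : Dec (Early v) → stage (toPar v) ≤ suc (dep v + dep v)
    go (yes e) = ≤-trans (≤-reflexive (stage-early ¬l e)) (n≤1+n _)
    go (no ¬e) = ≤-reflexive (stage-late ¬l ¬e)

  stage-≥ : ∀ v → dep v + dep v ≤ stage (toPar v)
  stage-≥ v with leaf? v | early? v
  ... | yes l | _     = subst (λ m → m + m ≤ suc (order (place v)) + (d + d)) (sym (leaf⇒dep l)) (m≤n+m (d + d) (suc (order (place v))))
  ... | no  _ | yes _ = ≤-refl
  ... | no  _ | no  _ = n≤1+n _

  double-< : ∀ {a b} → a < b → suc (a + a) < b + b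
  double-< {a} {b} lt = begin-strict
    suc (a + a)   <⟨ n<1+n _ ⟩
    suc (suc (a + a)) ≡⟨ cong suc (+-suc a a) ⟨
    suc a + suc a ≤⟨ +-mono-≤ lt lt ⟩
    b + b         ∎
    where open ≤-Reasoning

  above-earlier : ∀ {a v} → ¬ Leaf T a → dep a < dep v → rank (toPar a) < rank (toPar v)
  above-earlier {a} {v} ¬l lt = rank-stage {toPar a} {toPar v} (≤-<-trans (stage-≤ ¬l) (<-≤-trans (double-< lt) (stage-≥ v)))

  interior-stage : ∀ {a} → ¬ Leaf T a → stage (toPar a) < d + d
  interior-stage ¬l = ≤-<-trans (stage-≤ ¬l) (double-< (not-leaf⇒dep< ¬l))

  order≤4 : ∀ p → order p ≤ 4
  order≤4 atFirst       = z≤n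
  order≤4 atFinal       = s≤s z≤n
  order≤4 atSecond      = s≤s (s≤s z≤n)
  order≤4 atPenultimate = s≤s (s≤s (s≤s z≤n))
  order≤4 elsewhere     = ≤-refl

  toPar-before-inner : ∀ v {u} → ¬ Cross u → rank (toPar v) < rank (toNext u)
  toPar-before-inner v {u} ¬c = rank-stage {toPar v} {toNext u} (subst (stage (toPar v) <_) (sym (stage-inner ¬c)) (lem (leaf? v)))
    where
    lem : Dec (Leaf T v) → stage (toPar v) < 6 + (d + d)
    lem (yes l) = subst (_< 6 + (d + d)) (sym (stage-pendant l)) (+-monoˡ-≤ (d + d) (s≤s (s≤s (order≤4 (place v)))))
    lem (no ¬l) = <-≤-trans (interior-stage ¬l) (m≤n+m (d + d) 6)

  interior-before-cross : ∀ {v u} → ¬ Leaf T v → Cross u → rank (toPar v) < rank (toNext u)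
  interior-before-cross {v} {u} ¬l c = rank-stage {toPar v} {toNext u} (subst (stage (toPar v) <_) (sym (stage-cross c)) (interior-stage ¬l))

  cross-before-pendant : ∀ {v u} → Leaf T v → Cross u → rank (toNext u) < rank (toPar v)
  cross-before-pendant {v} {u} l c = rank-stage {toNext u} {toPar v} (subst₂ _<_ (sym (stage-cross c)) (sym (stage-pendant l)) (s≤s (m≤n+m (d + d) (order (place v)))))

  cross-before-inner : ∀ {w u} → Cross w → ¬ Cross u → rank (toNext w) < rank (toNext u)
  cross-before-inner {w} {u} c ¬c = rank-stage {toNext w} {toNext u} (subst₂ _<_ (sym (stage-cross c)) (sym (stage-inner ¬c)) (m<n+m (d + d) {6} (s≤s z≤n)))

  toPar-∈-at-par : ∀ {x v} → x ≢ r → par x ≡ v → {is : List (Item N)} → edge v x ∈ is → toPar x ∈ is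
  toPar-∈-at-par x≢r refl {is} = subst (_∈ is) (edge-up x≢r)

  module _ {v : Fin N} where
    -- Siblings at equal named places coincide, larger places are excluded by the order, and
    -- `elsewhere` lists all siblings.
    lower-pendant : ∀ {u x} → Leaf T u → Leaf T x → par u ≡ v → par x ≡ v → x ≢ u →
                    order (place x) ≤ order (place u) → toPar x ∈ pendantConflicts u (place u)
    lower-pendant {u} {x} lu lx refl px x≢u le with locate u | locate x
    ... | _ , isElsewhere _ _ _ _ | _ = ∈-++⁺ˡ (toPar-∈-at-par (leaf≢r lx) px (∈-otherEdges (subst (λ z → Adj T z x) px (par-∼′ (leaf≢r lx))) x≢u))
    ... | _ , isFirst p | _ , isFirst q = contradiction (trans q (trans (cong first px) (sym p))) x≢u
    ... | _ , isFinal p | _ , isFirst q = there (here (cong toPar (trans q (cong first px))))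
    ... | _ , isFinal p | _ , isFinal q = contradiction (trans q (trans (cong final px) (sym p))) x≢u
    ... | _ , isSecond p | _ , isFirst q = here (cong toPar (trans q (cong first px)))
    ... | _ , isSecond p | _ , isFinal q = there (here (cong toPar (trans q (cong final px))))
    ... | _ , isSecond p | _ , isSecond q = contradiction (trans q (trans (cong (next ∘ first) px) (sym p))) x≢u
    ... | _ , isPenultimate p | _ , isFirst q = here (cong toPar (trans q (cong first px)))
    ... | _ , isPenultimate p | _ , isFinal q = there (here (cong toPar (trans q (cong final px))))
    ... | _ , isPenultimate p | _ , isSecond q = there (there (here (cong toPar (trans q (cong (next ∘ first) px)))))
    ... | _ , isPenultimate p | _ , isPenultimate q = contradiction (trans q (trans (cong (prev ∘ final) px) (sym p))) x≢u
    ... | _ , isFinal p | _ , isSecond _ = contradiction le λ { (s≤s ()) }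
    ... | _ , isFinal p | _ , isPenultimate _ = contradiction le λ { (s≤s ()) }
    ... | _ , isFinal p | _ , isElsewhere _ _ _ _ = contradiction le λ { (s≤s ()) }
    ... | _ , isSecond p | _ , isPenultimate _ = contradiction le λ { (s≤s (s≤s ())) }
    ... | _ , isSecond p | _ , isElsewhere _ _ _ _ = contradiction le λ { (s≤s (s≤s ())) }
    ... | _ , isPenultimate p | _ , isElsewhere _ _ _ _ = contradiction le λ { (s≤s (s≤s (s≤s ()))) }

  -- If `y` is early, so is `x`, since a late sibling has a larger stage; thus `x` lies in the half
  -- listed by `y`.
  earlier-sibling : ∀ {x y} → x ≢ r → y ≢ r → par x ≡ par y → x ≢ y → rank (toPar x) < rank (toPar y) →
                    toPar x ∈ conflicts (toPar y)
  earlier-sibling {x} {y} x≢r y≢r e x≢y lt = go (leaf? y) (early? y)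
    where
    x∼ : Adj T (par y) x
    x∼ = subst (λ z → Adj T z x) e (par-∼′ x≢r)
    stages : stage (toPar x) ≤ stage (toPar y)
    stages = rank⇒stage {toPar x} {toPar y} lt
    go : Dec (Leaf T y) → Dec (Early y) → toPar x ∈ conflicts (toPar y)
    go (yes l) _ = ∈-unfold (conflicts-pendant l) (lower-pendant l lx refl e x≢y
      (+-cancelʳ-≤ (d + d) _ _ (≤-pred (subst₂ _≤_ (stage-pendant lx) (stage-pendant l) stages))))
      where
      lx : Leaf T x
      lx = sibling-leaf l x≢r e
    go (no ¬l) (no ¬e) = ∈-unfold (conflicts-late ¬l ¬e)
      (∈-++⁺ˡ (toPar-∈-at-par x≢r e (∈-otherEdges x∼ x≢y)))
    go (no ¬l) (yes ey) = ∈-unfold (conflicts-early ¬l ey)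
      (∈-++⁺ʳ (edgesAt (par (par y))) (toPar-∈-at-par x≢r e (∈-map⁺ (edge (par y)) (subst (λ z → x ∈ ahead z (par z)) e (proj₂ ex)))))
      where
      ¬lx : ¬ Leaf T x
      ¬lx l = ¬l (sibling-leaf l y≢r (sym e))
      same-dep : dep x ≡ dep y
      same-dep = trans (dep-par x≢r) (trans (cong (suc ∘ dep) e) (sym (dep-par y≢r)))
      ex : Early x
      ex = decidable-stable (early? x) λ ¬p → contradiction (subst₂ _≤_ (trans (stage-late ¬lx ¬p) (cong (λ m → suc (m + m)) same-dep)) (stage-early ¬l ey) stages) (<⇒≱ (n<1+n _))

  siblings-≢ : ∀ {x y} → x ≢ r → y ≢ r → par x ≡ par y → x ≢ y → colour (toPar x) ≢ colour (toPar y)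
  siblings-≢ {x} {y} x≢r y≢r e x≢y with <-cmp (rank (toPar x)) (rank (toPar y))
  ... | tri< lt _ _ = ≢-sym (colour-≢ (toPar-free y≢r) (earlier-sibling x≢r y≢r e x≢y lt) lt)
  ... | tri≈ _ eq _ = contradiction (rank-vertex {toPar x} {toPar y} eq) x≢y
  ... | tri> _ _ gt = colour-≢ (toPar-free x≢r) (earlier-sibling y≢r x≢r (sym e) (≢-sym x≢y) gt) gt

  pendant-parent-∈ : ∀ {u} → Leaf T u → par u ≢ r → toPar (par u) ∈ pendantConflicts u (place u)
  pendant-parent-∈ {u} l v≢r with locate u
  ... | _ , isFirst _       = there (here refl)
  ... | _ , isFinal _       = there (there (here refl))
  ... | _ , isSecond _      = there (there (here refl))
  ... | _ , isPenultimate _ = there (there (there (here refl)))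
  ... | _ , isElsewhere _ _ _ _ =
    ∈-++⁺ˡ (subst (_∈ otherEdges (par u) u) (edge-par refl) (∈-otherEdges (par-∼ v≢r) (≢-sym (par≢ (leaf≢r l)))))

  pendant-halfAbove-∈ : ∀ {u i} → i ∈ halfAbove (par u) → i ∈ pendantConflicts u (place u)
  pendant-halfAbove-∈ {u} i∈ with locate u
  ... | _ , isFirst _           = ∈-++⁺ʳ (toPar (prev u) ∷ toPar (par u) ∷ crossesOf (par u)) i∈
  ... | _ , isFinal _           = ∈-++⁺ʳ (toPar (next u) ∷ toPar (first (par u)) ∷ toPar (par u) ∷ crossesOf (par u)) i∈
  ... | _ , isSecond _          = ∈-++⁺ʳ (toPar (first (par u)) ∷ toPar (final (par u)) ∷ toPar (par u) ∷ crossesOf (par u)) i∈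
  ... | _ , isPenultimate _     = ∈-++⁺ʳ (toPar (first (par u)) ∷ toPar (final (par u)) ∷ toPar (next (first (par u))) ∷ toPar (par u) ∷ crossesOf (par u)) i∈
  ... | _ , isElsewhere _ _ _ _ = ∈-++⁺ʳ (otherEdges (par u) u) i∈

  parent-≢ : ∀ {v} → v ≢ r → par v ≢ r → colour (toPar v) ≢ colour (toPar (par v))
  parent-≢ {v} v≢r m≢r = colour-≢ (toPar-free v≢r) (go (leaf? v) (early? v))
                                   (above-earlier (parent-not-leaf v≢r) (dep-child v≢r))
    where
    go : Dec (Leaf T v) → Dec (Early v) → toPar (par v) ∈ conflicts (toPar v)
    go (yes l) _       = ∈-unfold (conflicts-pendant l) (pendant-parent-∈ l m≢r)
    go (no ¬l) (yes e) = ∈-unfold (conflicts-early ¬l e)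
      (∈-++⁺ˡ (toPar-∈-at-par m≢r refl (∈-edgesAt (par-∼′ m≢r))))
    go (no ¬l) (no ¬e) = ∈-unfold (conflicts-late ¬l ¬e)
      (∈-++⁺ˡ (subst (_∈ otherEdges (par v) v) (edge-par refl) (∈-otherEdges (par-∼ m≢r) (≢-sym (par≢ v≢r)))))

  edges-≢ : ∀ {u v w} → Adj T u v → Adj T u w → v ≢ w → colour (edge u v) ≢ colour (edge u w)
  edges-≢ {u} {v} {w} e e′ v≢w with par-or-child e | par-or-child e′
  ... | inj₁ (_ , p) | inj₁ (_ , q) = contradiction (trans (sym p) q) v≢w
  ... | inj₁ (u≢r , refl) | inj₂ (w≢r , refl) =
    subst₂ (λ i j → colour i ≢ colour j) (sym (edge-par refl)) (sym (edge-up w≢r)) (≢-sym (parent-≢ w≢r u≢r))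
  ... | inj₂ (v≢r , refl) | inj₁ (u≢r , refl) =
    subst₂ (λ i j → colour i ≢ colour j) (sym (edge-up v≢r)) (sym (edge-par refl)) (parent-≢ v≢r u≢r)
  ... | inj₂ (v≢r , refl) | inj₂ (w≢r , q) =
    subst₂ (λ i j → colour i ≢ colour j) (sym (edge-up v≢r)) (trans (sym (edge-up w≢r)) (cong (λ m → edge m w) q)) (siblings-≢ v≢r w≢r (sym q) v≢w)

  edge-before : ∀ {m z v} → Adj T m z → ¬ Leaf T m → ¬ Leaf T z → dep m < dep v → dep z < dep v → rank (edge m z) < rank (toPar v)
  edge-before {m} {z} {v} e ¬m ¬z m< z< with par-or-child e
  ... | inj₁ (_ , p)    = subst (λ i → rank i < rank (toPar v)) (sym (edge-par (sym p))) (above-earlier ¬m m<)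
  ... | inj₂ (z≢r , refl) = subst (λ i → rank i < rank (toPar v)) (sym (edge-up z≢r)) (above-earlier ¬z z<)

  halfAbove-conflict : ∀ {a i} → a ≢ r → par a ≢ r → i ∈ halfAbove (par a) → i ∈ edgesAt (par (par a)) → i ∈ conflicts (toPar a)
  halfAbove-conflict {a} {i} a≢r x≢r i∈ i∈′ = go (leaf? a) (early? a)
    where
    go : Dec (Leaf T a) → Dec (Early a) → i ∈ conflicts (toPar a)
    go (yes l) _       = ∈-unfold (conflicts-pendant l) (pendant-halfAbove-∈ i∈)
    go (no ¬l) (yes e) = ∈-unfold (conflicts-early ¬l e) (∈-++⁺ˡ i∈′)
    go (no ¬l) (no ¬e) = ∈-unfold (conflicts-late ¬l ¬e) (∈-++⁺ʳ (otherEdges (par a) a) i∈)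

  -- Here `x` has charge of `z`. If `x` is a child of `m`, then `a` is a child of `x` and avoids
  -- `halfAbove x`. If `x` is the parent of `m`, then `z` is an early child of `m` and avoids all
  -- edges at `x`.
  ahead-≢ : ∀ {a x m z} → Adj T x a → Adj T m x → Adj T m z → a ≢ m → x ≢ z → ¬ Leaf T z →
            z ∈ ahead m x → colour (edge x a) ≢ colour (edge m z)
  ahead-≢ {a} {x} {m} {z} xa mx mz a≢m x≢z ¬z z∈ with par-or-child mx
  ... | inj₂ (x≢r , refl) with child xa a≢m
  ...   | a≢r , refl = subst (λ i → colour i ≢ colour (edge m z)) (sym (edge-up a≢r))
          (colour-≢ (toPar-free a≢r) (halfAbove-conflict a≢r x≢r (∈-halfAbove x≢r z∈) (∈-edgesAt mz))
            (edge-before mz (parent-not-leaf x≢r) ¬z (<-trans (dep-child x≢r) (dep-child a≢r)) dz))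
    where
    dz : dep z < dep a
    dz with par-or-child mz
    ... | inj₁ (m≢r , refl) = <-trans (dep-child m≢r) (<-trans (dep-child x≢r) (dep-child a≢r))
    ... | inj₂ (z≢r , q)    = subst (_< dep a) (trans (dep-par x≢r) (trans (cong (suc ∘ dep) (sym q)) (sym (dep-par z≢r)))) (dep-child a≢r)
  ahead-≢ {a} {x} {m} {z} xa mx mz a≢m x≢z ¬z z∈ | inj₁ (m≢r , refl) with child mz (≢-sym x≢z)
  ...   | z≢r , refl = subst (λ i → colour (edge x a) ≢ colour i) (sym (edge-up z≢r))
          (≢-sym (colour-≢ (toPar-free z≢r) (∈-unfold (conflicts-early ¬z (m≢r , z∈)) (∈-++⁺ˡ (∈-edgesAt xa)))
            (edge-before xa (parent-not-leaf m≢r) ¬a (<-trans (dep-child m≢r) (dep-child z≢r)) da)))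
    where
    da : dep a < dep z
    da with par-or-child xa
    ... | inj₁ (x≢r , refl) = <-trans (dep-child x≢r) (<-trans (dep-child m≢r) (dep-child z≢r))
    ... | inj₂ (a≢r , q)    = subst (_< dep z) (trans (dep-par m≢r) (trans (cong (suc ∘ dep) (sym q)) (sym (dep-par a≢r)))) (dep-child z≢r)
    ¬a : ¬ Leaf T a
    ¬a l = <⇒≱ da (subst (dep z ≤_) (sym (leaf⇒dep l)) (dep≤d z))

  edge-toPar : ∀ m z → ∃[ w ] edge m z ≡ toPar w
  edge-toPar m z with z Fin.≟ par m
  ... | yes _ = m , refl
  ... | no  _ = z , refl

  -- Colours of cycle edges.

  inner-edge-≢ : ∀ {u z} → Leaf T u → ¬ Cross u → Adj T (par u) z → colour (toNext u) ≢ colour (edge (par u) z)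
  inner-edge-≢ {u} {z} l ¬c e = colour-≢ (toNext-free l)
    (∈-unfold (conflicts-inner ¬c) (there (there (there (there (∈-edgesAt e))))))
    (let w , eq = edge-toPar (par u) z in subst (λ i → rank i < rank (toNext u)) (sym eq) (toPar-before-inner w ¬c))

  inner-sibling-≢ : ∀ {u w} → Leaf T u → ¬ Cross u → w ≢ r → par w ≡ par u → colour (toNext u) ≢ colour (toPar w)
  inner-sibling-≢ {u} {w} l ¬c w≢r e = subst (λ i → colour (toNext u) ≢ colour i)
    (trans (cong (λ m → edge m w) (sym e)) (edge-up w≢r)) (inner-edge-≢ l ¬c (subst (λ m → Adj T m w) e (par-∼′ w≢r)))

  second-right-cross : ∀ {u} → Cross (next u) → second-right u ≡ toPar (next (next u))
  second-right-cross {u} c with cross? (next u)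
  ... | yes _ = refl
  ... | no ¬c = contradiction c ¬c

  second-right-inner : ∀ {u} → ¬ Cross (next u) → second-right u ≡ toNext (next (next u))
  second-right-inner {u} ¬c with cross? (next u)
  ... | yes c = contradiction c ¬c
  ... | no  _ = refl

  second-left-cross : ∀ {u} → Cross (prev u) → second-left u ≡ toPar (prev u)
  second-left-cross {u} c with cross? (prev u)
  ... | yes _ = refl
  ... | no ¬c = contradiction c ¬c

  second-left-inner : ∀ {u} → ¬ Cross (prev u) → second-left u ≡ toNext (prev (prev u))
  second-left-inner {u} ¬c with cross? (prev u)
  ... | yes c = contradiction c ¬c
  ... | no  _ = refl

  conflict-right : ∀ {u} → ¬ Cross u → toNext (next u) ∈ conflicts (toNext u)
  conflict-right ¬c = ∈-unfold (conflicts-inner ¬c) (here refl)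

  conflict-left : ∀ {u} → Leaf T u → ¬ Cross (next u) → toNext u ∈ conflicts (toNext (next u))
  conflict-left l ¬c = ∈-unfold (conflicts-inner ¬c) (there (there (here (cong toNext (sym (prev-next l))))))

  conflict-right² : ∀ {u} → ¬ Cross u → ¬ Cross (next u) → toNext (next (next u)) ∈ conflicts (toNext u)
  conflict-right² ¬c ¬c′ = ∈-unfold (conflicts-inner ¬c) (there (here (sym (second-right-inner ¬c′))))

  conflict-left² : ∀ {u} → Leaf T u → ¬ Cross (next u) → ¬ Cross (next (next u)) →
                   toNext u ∈ conflicts (toNext (next (next u)))
  conflict-left² {u} l ¬c ¬c′ = ∈-unfold (conflicts-inner ¬c′) (there (there (there (here (sym
    (trans (second-left-inner (subst (λ w → ¬ Cross w) (sym back) ¬c)) (cong toNext (trans (cong prev back) (prev-next l)))))))))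
    where
    back : prev (next (next u)) ≡ next u
    back = prev-next (next-leaf l)

  cycle-≢ : ∀ {u} → Leaf T u → colour (toNext u) ≢ colour (toNext (next u))
  cycle-≢ {u} l = go (cross? u) (cross? (next u))
    where
    fu = toNext-free l
    fn = toNext-free (next-leaf l)
    go : Dec (Cross u) → Dec (Cross (next u)) → colour (toNext u) ≢ colour (toNext (next u))
    go (yes c) (yes c′) = contradiction c′ (cross-next-inner l c)
    go (yes c) (no ¬c′) = ≢-sym (colour-≢ fn (conflict-left l ¬c′) (cross-before-inner c ¬c′))
    go (no ¬c) (yes c′) = colour-≢ fu (conflict-right ¬c) (cross-before-inner c′ ¬c)
    go (no ¬c) (no ¬c′) = apart fu fn (conflict-left l ¬c′) (conflict-right ¬c) (≢-sym (next≢ l))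

  prev-first : ∀ {u} → Leaf T u → Cross u → prev (first (par (next u))) ≡ u
  prev-first l c = trans (cong prev (first-cross l c)) (prev-next l)

  cycle²-≢ : ∀ {u} → Leaf T u → ¬ Cross (next u) → colour (toNext u) ≢ colour (toNext (next (next u)))
  cycle²-≢ {u} l ¬m = go (cross? u) (cross? (next (next u)))
    where
    l″ = next-leaf (next-leaf l)
    fu = toNext-free l
    fn = toNext-free l″
    go : Dec (Cross u) → Dec (Cross (next (next u))) → colour (toNext u) ≢ colour (toNext (next (next u)))
    -- The two edges enter and leave the same group, so each appears in the list of the other.
    go (yes c) (yes c′) = apart fu fn
      (∈-unfold (conflicts-cross c′) (there (there (here (cong toNext (sym (trans (cong (prev ∘ first) (inner ¬m)) (prev-first l c))))))))
      (∈-unfold (conflicts-cross c) (there (there (there (here (cong toNext (sym (trans (cong final (sym (inner ¬m))) (final-cross l″ c′)))))))))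
      (≢-sym (next²≢ l))
    go (yes c) (no ¬c′) = ≢-sym (colour-≢ fn (conflict-left² l ¬m ¬c′) (cross-before-inner c ¬c′))
    go (no ¬c) (yes c′) = colour-≢ fu (conflict-right² ¬c ¬m) (cross-before-inner c′ ¬c)
    go (no ¬c) (no ¬c′) = apart fu fn (conflict-left² l ¬m ¬c′) (conflict-right² ¬c ¬m) (≢-sym (next²≢ l))

  NearEnd : Fin N → Set
  NearEnd u = u ≡ first (par u) ⊎ u ≡ final (par u) ⊎ u ≡ next (first (par u)) ⊎ u ≡ prev (final (par u))

  -- `locate` may report another of the four named places than the one in `NearEnd`, but all four
  -- lists contain the crossing edges.
  nearEnd-crosses : ∀ {u i} → NearEnd u → i ∈ crossesOf (par u) → i ∈ pendantConflicts u (place u)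
  nearEnd-crosses {u} near i∈ with locate u
  ... | _ , isFirst _       = there (there (∈-++⁺ˡ i∈))
  ... | _ , isFinal _       = there (there (there (∈-++⁺ˡ i∈)))
  ... | _ , isSecond _      = there (there (there (∈-++⁺ˡ i∈)))
  ... | _ , isPenultimate _ = there (there (there (there (∈-++⁺ˡ i∈))))
  ... | _ , isElsewhere p q s t with near
  ...   | inj₁ e               = contradiction e p
  ...   | inj₂ (inj₁ e)        = contradiction e q
  ...   | inj₂ (inj₂ (inj₁ e)) = contradiction e s
  ...   | inj₂ (inj₂ (inj₂ e)) = contradiction e t

  nearEnd-out-≢ : ∀ {s u} → Leaf T s → NearEnd s → Leaf T u → Cross u → par u ≡ par s →
                  colour (toPar s) ≢ colour (toNext u)
  nearEnd-out-≢ {s} {u} ls near l c e = colour-≢ (toPar-free (leaf≢r ls))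
    (∈-unfold (conflicts-pendant ls) (nearEnd-crosses near
      (there (here (cong toNext (sym (trans (cong final (sym e)) (final-cross l c))))))))
    (cross-before-pendant ls c)

  nearEnd-in-≢ : ∀ {s u} → Leaf T s → NearEnd s → Leaf T u → Cross u → par (next u) ≡ par s →
                 colour (toPar s) ≢ colour (toNext u)
  nearEnd-in-≢ {s} {u} ls near l c e = colour-≢ (toPar-free (leaf≢r ls))
    (∈-unfold (conflicts-pendant ls) (nearEnd-crosses near
      (here (cong toNext (sym (trans (cong (prev ∘ first) (sym e)) (prev-first l c)))))))
    (cross-before-pendant ls c)

  cross-isFinal : ∀ {u} → Leaf T u → Cross u → u ≡ final (par u)
  cross-isFinal l c = sym (final-cross l c)

  cross-isFirst : ∀ {u} → Leaf T u → Cross u → next u ≡ first (par (next u))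
  cross-isFirst l c = sym (first-cross l c)

  pendant-≢ : ∀ {u} → Leaf T u → colour (toPar u) ≢ colour (toNext u)
  pendant-≢ {u} l = go (cross? u)
    where
    go : Dec (Cross u) → colour (toPar u) ≢ colour (toNext u)
    go (yes c) = nearEnd-out-≢ l (inj₂ (inj₁ (cross-isFinal l c))) l c refl
    go (no ¬c) = ≢-sym (inner-sibling-≢ l ¬c (leaf≢r l) refl)

  next-pendant-≢ : ∀ {u} → Leaf T u → colour (toPar (next u)) ≢ colour (toNext u)
  next-pendant-≢ {u} l = go (cross? u)
    where
    go : Dec (Cross u) → colour (toPar (next u)) ≢ colour (toNext u)
    go (yes c) = nearEnd-in-≢ (next-leaf l) (inj₁ (cross-isFirst l c)) l c refl
    go (no ¬c) = ≢-sym (inner-sibling-≢ l ¬c (leaf≢r (next-leaf l)) (inner ¬c))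

  -- If `u` crosses, the pendant edge is second in its group and avoids the crossing edge. If
  -- `next u` crosses, it is `second-right u`. Otherwise it is a tree edge at `par u`.
  next²-pendant-≢ : ∀ {u} → Leaf T u → colour (toPar (next (next u))) ≢ colour (toNext u)
  next²-pendant-≢ {u} l = go (cross? u) (cross? (next u))
    where
    l″ = next-leaf (next-leaf l)
    go : Dec (Cross u) → Dec (Cross (next u)) → colour (toPar (next (next u))) ≢ colour (toNext u)
    go (yes c) (yes c′) = contradiction c′ (cross-next-inner l c)
    go (yes c) (no ¬c′) = nearEnd-in-≢ l″ (inj₂ (inj₂ (inj₁ (cong next (trans (cross-isFirst l c) (cong first (sym (inner ¬c′)))))))) l c (sym (inner ¬c′))
    go (no ¬c) (yes c′) = ≢-sym (colour-≢ (toNext-free l)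
      (∈-unfold (conflicts-inner ¬c) (there (here (sym (second-right-cross c′))))) (toPar-before-inner _ ¬c))
    go (no ¬c) (no ¬c′) = ≢-sym (inner-sibling-≢ l ¬c (leaf≢r l″) (trans (inner ¬c′) (inner ¬c)))

  pendant-next²-≢ : ∀ {u} → Leaf T u → colour (toPar u) ≢ colour (toNext (next u))
  pendant-next²-≢ {u} l = go (cross? u) (cross? (next u))
    where
    l′ = next-leaf l
    go : Dec (Cross u) → Dec (Cross (next u)) → colour (toPar u) ≢ colour (toNext (next u))
    go (yes c) (yes c′) = contradiction c′ (cross-next-inner l c)
    go (yes c) (no ¬c′) = ≢-sym (colour-≢ (toNext-free l′)
      (∈-unfold (conflicts-inner ¬c′) (there (there (there (here (sym
        (trans (second-left-cross (subst Cross (sym (prev-next l)) c)) (cong toPar (prev-next l)))))))))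
      (toPar-before-inner u ¬c′))
    go (no ¬c) (yes c′) = nearEnd-out-≢ l (inj₂ (inj₂ (inj₂ (trans (sym (prev-next l)) (cong prev (trans (cross-isFinal l′ c′) (cong final (inner ¬c)))))))) l′ c′ (inner ¬c)
    go (no ¬c) (no ¬c′) = ≢-sym (inner-sibling-≢ l′ ¬c′ (leaf≢r l) (sym (inner ¬c)))

  -- Across a crossing edge, `u` is final and `next u` is first in its group. Their lists name each
  -- other, provided that `u` is not itself located at the first place.
  pendants-≢ : ∀ {u} → Leaf T u → colour (toPar u) ≢ colour (toPar (next u))
  pendants-≢ {u} l = go (cross? u)
    where
    l′ = next-leaf l
    go : Dec (Cross u) → colour (toPar u) ≢ colour (toPar (next u))
    go (no ¬c) = siblings-≢ (leaf≢r l) (leaf≢r l′) (sym (inner ¬c)) (≢-sym (next≢ l))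
    go (yes c) = apart (toPar-free (leaf≢r l)) (toPar-free (leaf≢r l′))
      (∈-unfold (conflicts-pendant l′) in-next) (∈-unfold (conflicts-pendant l) in-u) (≢-sym (next≢ l))
      where
      not-first : u ≢ first (par u)
      not-first e = rot²≢ (parent-not-leaf (leaf≢r l)) (par-∼ (cross≢r l c))
        (trans (cong (rot (par u)) (sym e)) (cross-rot l c))
      in-u : toPar (next u) ∈ pendantConflicts u (place u)
      in-u with u Fin.≟ first (par u) | u Fin.≟ final (par u)
      ... | yes p | _     = contradiction p not-first
      ... | no  _ | yes _ = here refl
      ... | no  _ | no  q = contradiction (cross-isFinal l c) q
      in-next : toPar u ∈ pendantConflicts (next u) (place (next u))
      in-next with next u Fin.≟ first (par (next u))
      ... | yes _ = here (cong toPar (sym (prev-next l)))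
      ... | no  q = contradiction (cross-isFirst l c) q

  cross-above-≢ : ∀ {u} → Leaf T u → Cross u → colour (toNext u) ≢ colour (toPar (par u))
  cross-above-≢ l c = colour-≢ (toNext-free l) (∈-unfold (conflicts-cross c) (here refl))
    (interior-before-cross (parent-not-leaf (leaf≢r l)) c)

  cross-above-next-≢ : ∀ {u} → Leaf T u → Cross u → colour (toNext u) ≢ colour (toPar (par (next u)))
  cross-above-next-≢ l c = colour-≢ (toNext-free l) (∈-unfold (conflicts-cross c) (there (here refl)))
    (interior-before-cross (parent-not-leaf (leaf≢r (next-leaf l))) c)

  -- The colouring as a function on pairs of vertices.

  data Cyc (x y : Fin N) : Set where
    fwd : Leaf T x → next x ≡ y → Cyc x y
    bwd : Leaf T y → next y ≡ x → Cyc x y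

  -- The leaf that names the cycle edge, not the start of the traversal, so reversal preserves it.
  tail : ∀ {x y} → Cyc x y → Fin N
  tail {x} {y} (fwd _ _) = x
  tail {x} {y} (bwd _ _) = y

  reverse : ∀ {x y} → Cyc x y → Cyc y x
  reverse (fwd l e) = bwd l e
  reverse (bwd l e) = fwd l e

  tail-reverse : ∀ {x y} (k : Cyc x y) → tail (reverse k) ≡ tail k
  tail-reverse (fwd _ _) = refl
  tail-reverse (bwd _ _) = refl

  cyc-leafˡ : ∀ {x y} → Cyc x y → Leaf T x
  cyc-leafˡ (fwd l _)    = l
  cyc-leafˡ (bwd l refl) = next-leaf l

  cyc-leafʳ : ∀ {x y} → Cyc x y → Leaf T y
  cyc-leafʳ k = cyc-leafˡ (reverse k)

  leaf-not-∼ : ∀ {x y} → Leaf T x → Leaf T y → ¬ Adj T x y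
  leaf-not-∼ lx ly e = parent-not-leaf (leaf≢r lx) (subst (Leaf T) (leaf-inner lx e) ly)

  leaf-edge : ∀ {x y} → Leaf T x → Adj T x y → edge x y ≡ toPar x
  leaf-edge l e = edge-par (leaf-inner l e)

  leaf-edge′ : ∀ {x y} → Leaf T x → Adj T y x → edge y x ≡ toPar x
  leaf-edge′ l e = trans (edge-sym e) (leaf-edge l (∼-sym e))

  data Step (x y : Fin N) : Set where
    tree-edge  : Adj T x y → Step x y
    cycle-edge : Cyc x y → Step x y

  item : ∀ {x y} → Step x y → Item N
  item {x} {y} (tree-edge _)  = edge x y
  item         (cycle-edge k) = toNext (tail k)

  toStep : ∀ {x y} → HalinAdj T rot x y → Step x y
  toStep (inj₁ e)         = tree-edge e
  toStep (inj₂ (inj₁ nl)) = cycle-edge (fwd (proj₁ nl) (NextLeaf⇒next nl))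
  toStep (inj₂ (inj₂ nl)) = cycle-edge (bwd (proj₁ nl) (NextLeaf⇒next nl))

  -- On a cycle edge the test `next x ≡ y` finds the naming leaf; by `next²≢` it cannot succeed from
  -- both ends. Non-edges get an arbitrary colour.
  φ : Fin N → Fin N → ℕ
  φ x y with ∼-dec x y | next x Fin.≟ y
  ... | yes _ | _     = colour (edge x y)
  ... | no  _ | yes _ = colour (toNext x)
  ... | no  _ | no  _ = colour (toNext y)

  φ-item : ∀ {x y} (s : Step x y) → φ x y ≡ colour (item s)
  φ-item {x} {y} s with ∼-dec x y | next x Fin.≟ y
  φ-item (tree-edge _)              | yes _  | _     = refl
  φ-item (tree-edge e)              | no ¬e  | _     = contradiction e ¬e
  φ-item (cycle-edge k)             | yes e  | _     = contradiction e (leaf-not-∼ (cyc-leafˡ k) (cyc-leafʳ k))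
  φ-item (cycle-edge (fwd _ _))     | no _   | yes _ = refl
  φ-item (cycle-edge (fwd _ e))     | no _   | no ¬e = contradiction e ¬e
  φ-item (cycle-edge (bwd l refl))  | no _   | yes e = contradiction e (next²≢ l)
  φ-item (cycle-edge (bwd _ _))     | no _   | no _  = refl

  φ-sym : ∀ {x y} → Step x y → φ x y ≡ φ y x
  φ-sym s@(tree-edge e)  = trans (φ-item s) (trans (cong colour (edge-sym e)) (sym (φ-item (tree-edge (∼-sym e)))))
  φ-sym s@(cycle-edge k) = trans (φ-item s) (trans (cong (colour ∘ toNext) (sym (tail-reverse k))) (sym (φ-item (cycle-edge (reverse k)))))

  φ-∈ : ∀ x y → HalinAdj T rot x y → φ x y ∈ L x y
  φ-∈ x y h = subst (_∈ L x y) (sym (φ-item (toStep h))) (go (toStep h))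
    where
    flipped : ∀ {i} → i ∈ L y x → i ∈ L x y
    flipped {i} = subst (i ∈_) (sym (proj₁ lists x y h))
    go : (s : Step x y) → colour (item s) ∈ L x y
    go (tree-edge e) with par-or-child e
    ... | inj₁ (x≢r , refl) = subst (λ i → colour i ∈ L x y) (sym (edge-par refl)) (colour-∈ (toPar-free x≢r))
    ... | inj₂ (y≢r , refl) = flipped (subst (λ i → colour i ∈ L y x) (sym (edge-up y≢r)) (colour-∈ (toPar-free y≢r)))
    go (cycle-edge (fwd l refl)) = colour-∈ (toNext-free l)
    go (cycle-edge (bwd l refl)) = flipped (colour-∈ (toNext-free l))

  tree-cycle-≢ : ∀ {u v w} → Adj T u v → (k : Cyc u w) → colour (edge u v) ≢ colour (toNext (tail k))
  tree-cycle-≢ e (fwd l _)    = subst (λ i → colour i ≢ _) (sym (leaf-edge l e)) (pendant-≢ l)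
  tree-cycle-≢ e (bwd l refl) = subst (λ i → colour i ≢ _) (sym (leaf-edge (next-leaf l) e)) (next-pendant-≢ l)

  items-≢ : ∀ {u v w} (s : Step u v) (s′ : Step u w) → v ≢ w → colour (item s) ≢ colour (item s′)
  items-≢ (tree-edge e)  (tree-edge e′)  v≢w = edges-≢ e e′ v≢w
  items-≢ (tree-edge e)  (cycle-edge k)  _   = tree-cycle-≢ e k
  items-≢ (cycle-edge k) (tree-edge e)   _   = ≢-sym (tree-cycle-≢ e k)
  items-≢ (cycle-edge (fwd _ e))    (cycle-edge (fwd _ e′))   v≢w = contradiction (trans (sym e) e′) v≢w
  items-≢ (cycle-edge (fwd _ _))    (cycle-edge (bwd l refl)) _   = ≢-sym (cycle-≢ l)
  items-≢ (cycle-edge (bwd l refl)) (cycle-edge (fwd _ _))    _   = cycle-≢ l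
  items-≢ (cycle-edge (bwd l e))    (cycle-edge (bwd l′ e′))  v≢w = contradiction (next-injective l l′ (trans e (sym e′))) v≢w

  φ-proper : Proper (HalinAdj T rot) φ
  φ-proper u v w h h′ v≢w = subst₂ _≢_ (sym (φ-item (toStep h))) (sym (φ-item (toStep h′))) (items-≢ (toStep h) (toStep h′) v≢w)

  -- Excluding bichromatic paths and cycles.

  no-tct : ∀ {a b c e} → Adj T a b → Cyc b c → Adj T c e → colour (edge a b) ≢ colour (edge c e)
  no-tct ab k ce = subst₂ (λ i j → colour i ≢ colour j) (sym (leaf-edge′ (cyc-leafˡ k) ab)) (sym (leaf-edge (cyc-leafʳ k) ce)) (lem k)
    where
    lem : ∀ {b c} → Cyc b c → colour (toPar b) ≢ colour (toPar c)
    lem (fwd l refl) = pendants-≢ l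
    lem (bwd l refl) = ≢-sym (pendants-≢ l)

  no-tcc : ∀ {a b c e} → Adj T a b → Cyc b c → (k : Cyc c e) → b ≢ e → colour (edge a b) ≢ colour (toNext (tail k))
  no-tcc ab (fwd l refl) (fwd l′ refl) _   = subst (λ i → colour i ≢ _) (sym (leaf-edge′ l ab)) (pendant-next²-≢ l)
  no-tcc ab (fwd l e)    (bwd l′ e′)   b≢e = contradiction (next-injective l l′ (trans e (sym e′))) b≢e
  no-tcc ab (bwd l e)    (fwd l′ e′)   b≢e = contradiction (trans (sym e) e′) b≢e
  no-tcc ab (bwd l refl) (bwd l′ refl) _   = subst (λ i → colour i ≢ _) (sym (leaf-edge′ (next-leaf l) ab)) (next²-pendant-≢ l′)

  -- A non-crossing edge avoids all tree edges at `c`, and a crossing one avoids the edge above `c`.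
  -- Only a crossing edge and a child edge of `c` remain, and the children of `c` are leaves.
  ctt : ∀ {a b c e} (k : Cyc a b) → Adj T b c → Adj T c e → b ≢ e → colour (toNext (tail k)) ≡ colour (edge c e) →
        Cross (tail k) × Leaf T e
  ctt {a} {b} {c} {e} k bc ce b≢e eq = decidable-stable (cross? (tail k)) (λ ¬c → not-inner k ¬c (leaf-inner lb bc) eq) , leaf-e
    where
    lb : Leaf T b
    lb = cyc-leafʳ k
    not-inner : (k : Cyc a b) → ¬ Cross (tail k) → c ≡ par b → colour (toNext (tail k)) ≢ colour (edge c e)
    not-inner (fwd l refl) ¬c refl = subst (λ m → colour (toNext a) ≢ colour (edge m e)) (sym (inner ¬c))
                                       (inner-edge-≢ l ¬c (subst (λ m → Adj T m e) (inner ¬c) ce))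
    not-inner (bwd l _)    ¬c refl = inner-edge-≢ l ¬c ce
    not-up : (k : Cyc a b) → Cross (tail k) → c ≡ par b → colour (toNext (tail k)) ≢ colour (toPar c)
    not-up (fwd l refl) cr refl = cross-above-next-≢ l cr
    not-up (bwd l _)    cr refl = cross-above-≢ l cr
    leaf-e : Leaf T e
    leaf-e with par-or-child ce
    ... | inj₂ (e≢r , p) = sibling-leaf lb e≢r (trans p (leaf-inner lb bc))
    ... | inj₁ (_ , p) with cross? (tail k)
    ...   | yes cr = contradiction (trans eq (cong colour (edge-par (sym p)))) (not-up k cr (leaf-inner lb bc))
    ...   | no ¬c  = contradiction eq (not-inner k ¬c (leaf-inner lb bc))

  ccc : ∀ {a b c e} (k : Cyc a b) (k′ : Cyc b c) (k″ : Cyc c e) → a ≢ c → b ≢ e →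
        colour (toNext (tail k)) ≡ colour (toNext (tail k″)) → Cross (tail k′)
  ccc (fwd l e)    (bwd l′ e′)  _             a≢c _   _  = contradiction (next-injective l l′ (trans e (sym e′))) a≢c
  ccc (bwd l e)    (fwd l′ e′)  _             a≢c _   _  = contradiction (trans (sym e) e′) a≢c
  ccc _            (fwd l e)    (bwd l′ e′)   _   b≢e _  = contradiction (next-injective l l′ (trans e (sym e′))) b≢e
  ccc _            (bwd l e)    (fwd l′ e′)   _   b≢e _  = contradiction (trans (sym e) e′) b≢e
  ccc (fwd l refl) (fwd _ refl) (fwd _ refl)  _   _   eq = decidable-stable (cross? _) λ ¬c → cycle²-≢ l ¬c eq
  ccc (bwd _ refl) (bwd _ refl) (bwd l refl)  _   _   eq = decidable-stable (cross? _) λ ¬c → cycle²-≢ l ¬c (sym eq)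

  not-both-cross : ∀ {a b c} (k : Cyc a b) (k′ : Cyc b c) → a ≢ c → Cross (tail k) → ¬ Cross (tail k′)
  not-both-cross (fwd l refl) (fwd _ _)    _   = cross-next-inner l
  not-both-cross (fwd l e)    (bwd l′ e′)  a≢c = contradiction (next-injective l l′ (trans e (sym e′))) a≢c
  not-both-cross (bwd _ e)    (fwd _ e′)   a≢c = contradiction (trans (sym e) e′) a≢c
  not-both-cross (bwd _ _)    (bwd l refl) _   = flip (cross-next-inner l)

  -- By `ctt` both cycle edges cross. The sibling leaves `b` and `e` differ, so one is first and the
  -- other final; the pendant edge of the first avoids the crossing edge leaving the group.
  no-cttc : ∀ {a b c e g} (k : Cyc a b) → Adj T b c → Adj T c e → (k′ : Cyc e g) → b ≢ e →
            colour (toNext (tail k)) ≡ colour (edge c e) → colour (edge b c) ≢ colour (toNext (tail k′))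
  no-cttc {a} {b} {c} {e} k bc ce k′ b≢e eq eq′ = go k k′
      (proj₁ (ctt k bc ce b≢e eq))
      (subst Cross (tail-reverse k′) (proj₁ (ctt (reverse k′) (∼-sym ce) (∼-sym bc) (≢-sym b≢e)
        (trans (cong (colour ∘ toNext) (tail-reverse k′)) (trans (sym eq′) (cong colour (edge-sym bc)))))))
      (trans eq (cong colour (leaf-edge′ le ce)))
      (trans (cong colour (sym (leaf-edge lb bc))) eq′)
    where
    lb : Leaf T b
    lb = cyc-leafʳ k
    le : Leaf T e
    le = cyc-leafˡ k′
    same : par b ≡ par e
    same = trans (sym (leaf-inner lb bc)) (leaf-inner le (∼-sym ce))
    go : ∀ {a g} (k : Cyc a b) (k′ : Cyc e g) → Cross (tail k) → Cross (tail k′) →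
         colour (toNext (tail k)) ≡ colour (toPar e) → colour (toPar b) ≢ colour (toNext (tail k′))
    go (fwd l refl) (fwd l′ _)    c c′ _ = nearEnd-out-≢ lb (inj₁ (cross-isFirst l c)) l′ c′ (sym same)
    go (fwd l refl) (bwd l′ refl) c c′ _ = λ _ → b≢e (trans (cross-isFirst l c) (trans (cong first same) (sym (cross-isFirst l′ c′))))
    go (bwd l _)    (fwd l′ _)    c c′ _ = λ _ → b≢e (trans (cross-isFinal l c) (trans (cong final same) (sym (cross-isFinal l′ c′))))
    go (bwd l _)    (bwd l′ refl) c c′ q = λ _ → nearEnd-out-≢ le (inj₁ (cross-isFirst l′ c′)) l c same (sym q)

  -- Around `v₂` one of `v₁` and `v₃` has charge of the other, which is no leaf as the path uses two
  -- of its edges; `ahead-≢` refutes one of the equalities.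
  no-tttt : ∀ {v₀ v₁ v₂ v₃ v₄} → Adj T v₀ v₁ → Adj T v₁ v₂ → Adj T v₂ v₃ → Adj T v₃ v₄ →
            v₀ ≢ v₂ → v₁ ≢ v₃ → v₂ ≢ v₄ →
            colour (edge v₀ v₁) ≡ colour (edge v₂ v₃) → colour (edge v₁ v₂) ≢ colour (edge v₃ v₄)
  no-tttt {v₀} {v₁} {v₂} {v₃} {v₄} e₀ e₁ e₂ e₃ v₀≢v₂ v₁≢v₃ v₂≢v₄ eq eq′ with ahead-total (∼-sym e₁) e₂ v₁≢v₃
  ... | inj₁ v₃∈ = ahead-≢ (∼-sym e₀) (∼-sym e₁) e₂ v₀≢v₂ v₁≢v₃ (λ l → v₂≢v₄ (leaf-nbr-unique l (∼-sym e₂) e₃)) v₃∈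
                     (trans (cong colour (sym (edge-sym e₀))) eq)
  ... | inj₂ v₁∈ = ahead-≢ e₃ e₂ (∼-sym e₁) (≢-sym v₂≢v₄) (≢-sym v₁≢v₃) (λ l → v₀≢v₂ (leaf-nbr-unique l (∼-sym e₀) e₁)) v₁∈
                     (trans (sym eq′) (cong colour (edge-sym e₁)))

  -- In three consecutive edges whose outer two share a colour, the middle edge
  -- is a tree edge next to another tree edge, or a crossing cycle edge between
  -- two cycle edges.
  no-bichromatic : ∀ {v₀ v₁ v₂ v₃ v₄} (s₀ : Step v₀ v₁) (s₁ : Step v₁ v₂) (s₂ : Step v₂ v₃) (s₃ : Step v₃ v₄) →
                   v₀ ≢ v₂ → v₁ ≢ v₃ → v₂ ≢ v₄ →
                   colour (item s₀) ≡ colour (item s₂) → colour (item s₁) ≢ colour (item s₃)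
  no-bichromatic (tree-edge e₀) (tree-edge e₁) (tree-edge e₂) (tree-edge e₃) p q s = no-tttt e₀ e₁ e₂ e₃ p q s
  no-bichromatic (tree-edge e₀) (tree-edge e₁) (tree-edge e₂) (cycle-edge k₃) p q s _ eq′ =
    p (leaf-nbr-unique (proj₂ (ctt (reverse k₃) (∼-sym e₂) (∼-sym e₁) (≢-sym q)
      (trans (cong (colour ∘ toNext) (tail-reverse k₃)) (trans (sym eq′) (cong colour (edge-sym e₁)))))) (∼-sym e₀) e₁)
  no-bichromatic _ (tree-edge e₁) (cycle-edge k₂) (tree-edge e₃) p q s _ = no-tct e₁ k₂ e₃
  no-bichromatic _ (tree-edge e₁) (cycle-edge k₂) (cycle-edge k₃) p q s _ = no-tcc e₁ k₂ k₃ s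
  no-bichromatic (tree-edge e₀) (cycle-edge k₁) (tree-edge e₂) _ p q s eq _ = no-tct e₀ k₁ e₂ eq
  no-bichromatic (tree-edge e₀) (cycle-edge k₁) (cycle-edge k₂) _ p q s eq _ = no-tcc e₀ k₁ k₂ q eq
  no-bichromatic (cycle-edge k₀) (tree-edge e₁) (tree-edge e₂) (tree-edge e₃) p q s eq _ =
    s (leaf-nbr-unique (proj₂ (ctt k₀ e₁ e₂ q eq)) (∼-sym e₂) e₃)
  no-bichromatic (cycle-edge k₀) (tree-edge e₁) (tree-edge e₂) (cycle-edge k₃) p q s eq = no-cttc k₀ e₁ e₂ k₃ q eq
  no-bichromatic (cycle-edge k₀) (cycle-edge k₁) (tree-edge e₂) _ p q s eq _ =
    no-tcc (∼-sym e₂) (reverse k₁) (reverse k₀) (≢-sym p)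
      (trans (cong colour (sym (edge-sym e₂))) (trans (sym eq) (cong (colour ∘ toNext) (sym (tail-reverse k₀)))))
  no-bichromatic (cycle-edge k₀) (cycle-edge k₁) (cycle-edge k₂) (tree-edge e₃) p q s _ eq′ =
    no-tcc (∼-sym e₃) (reverse k₂) (reverse k₁) (≢-sym q)
      (trans (cong colour (sym (edge-sym e₃))) (trans (sym eq′) (cong (colour ∘ toNext) (sym (tail-reverse k₁)))))
  no-bichromatic (cycle-edge k₀) (cycle-edge k₁) (cycle-edge k₂) (cycle-edge k₃) p q s eq eq′ =
    not-both-cross k₁ k₂ q (ccc k₀ k₁ k₂ p q eq) (ccc k₁ k₂ k₃ q s eq′)

  -- With two colours available and consecutive edges distinct, the colours alternate.
  alternate : ∀ {a b x y z : ℕ} → x ≡ a ⊎ x ≡ b → y ≡ a ⊎ y ≡ b → z ≡ a ⊎ z ≡ b → x ≢ y → y ≢ z → x ≡ z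
  alternate (inj₁ refl) (inj₁ refl) _           x≢y _   = contradiction refl x≢y
  alternate (inj₁ refl) (inj₂ refl) (inj₁ refl) _   _   = refl
  alternate (inj₁ refl) (inj₂ refl) (inj₂ refl) _   y≢z = contradiction refl y≢z
  alternate (inj₂ refl) (inj₂ refl) _           x≢y _   = contradiction refl x≢y
  alternate (inj₂ refl) (inj₁ refl) (inj₂ refl) _   _   = refl
  alternate (inj₂ refl) (inj₁ refl) (inj₁ refl) _   y≢z = contradiction refl y≢z

  φ-star : IsStarEdgeColouring (HalinAdj T rot) φ
  φ-star = (λ x y h → φ-sym (toStep h)) , φ-proper , star
    where
    consecutive-≢ : ∀ {x y z} → HalinAdj T rot x y → HalinAdj T rot y z → x ≢ z → φ x y ≢ φ y z
    consecutive-≢ {x} {y} {z} h h′ x≢z eq = φ-proper y x z (flip-adj h) h′ x≢z (trans (sym (φ-sym (toStep h))) eq)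
      where
      flip-adj : HalinAdj T rot x y → HalinAdj T rot y x
      flip-adj (inj₁ e)         = inj₁ (∼-sym e)
      flip-adj (inj₂ (inj₁ nl)) = inj₂ (inj₂ nl)
      flip-adj (inj₂ (inj₂ nl)) = inj₂ (inj₁ nl)
    star : ∀ v₀ v₁ v₂ v₃ v₄ → PathOrCycle4 (HalinAdj T rot) v₀ v₁ v₂ v₃ v₄ → ¬ Bichromatic4 φ v₀ v₁ v₂ v₃ v₄
    star _ _ _ _ _ (h₀ , h₁ , h₂ , h₃ , _ , v₀≢v₂ , _ , _ , v₁≢v₃ , _ , _ , v₂≢v₄ , _) (a , b , c₀ , c₁ , c₂ , c₃) =
      no-bichromatic (toStep h₀) (toStep h₁) (toStep h₂) (toStep h₃) v₀≢v₂ v₁≢v₃ v₂≢v₄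
        (subst₂ _≡_ (φ-item (toStep h₀)) (φ-item (toStep h₂)) (alternate c₀ c₁ c₂ p₀ p₁))
        (subst₂ _≡_ (φ-item (toStep h₁)) (φ-item (toStep h₃)) (alternate c₁ c₂ c₃ p₁ p₂))
      where
      p₀ = consecutive-≢ h₀ h₁ v₀≢v₂
      p₁ = consecutive-≢ h₁ h₂ v₁≢v₃
      p₂ = consecutive-≢ h₂ h₃ v₂≢v₄

theorem13 : ∀ {n : ℕ} (T : BGraph n) (rot : Fin n → Fin n → Fin n)
    → IsHalinData T rot → IsComplete T
    → length (leaves T) ≢ 5
    → StarEdgeChoosable (HalinAdj T rot) (halinBound T)
theorem13 T rot halin (r , d , complete) _ L lists = φ , φ-star , φ-∈
  where open Colouring T rot halin r d complete L lists
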